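{- Let $\nu$ be a (nonskew) diagram. The image of the supersymmetric Schur function $s_\nu(x/y\|a)$ under the isomorphism $\Lambda(x/y\|a)\to\Lambda(x\|a)$ given by the evaluation $y_i\mapsto -a_i$ for all $i\geqslant 1$ coincides with the double Schur function $s_\nu(x\|a)$; that is, $$s_\nu(x/y\|a)\big|_{y=-a}=s_\nu(x\|a),$$ where $y=-a$ denotes the evaluation $y_i=-a_i$ for $i\geqslant 1$.
   Context: Let $a=(a_i)_{i\in\mathbb Z}$ be a sequence of commuting indeterminates and $\mathbb Q[a]$ the polynomial ring in the $a_i$. The ring $\Lambda(x\|a)$: its elements are sequences $P=(P_0,P_1,P_2,\dots)$, where $P_n$ is a symmetric polynomial in $x_1,\dots,x_n$ with coefficients in $\mathbb Q[a]$, the total degrees of the $P_n$ in the $x_i$ are bounded, and $P_n(x_1,\dots,x_{n-1},a_n)=P_{n-1}(x_1,\dots,x_{n-1})$ for all $n\geqslant 1$; multiplication is componentwise. It is freely generated over $\mathbb Q[a]$ by the double power sums $p_k(x\|a)=\sum_{i\geqslant 1}(x_i^k-a_i^k)$, $k\geqslant 1$. Double Schur functions: for a partition $\lambda$ with $\ell(\lambda)\leqslant n$, $$s_\lambda(x_1,\dots,x_n\|a)=\frac{\det\big[(x_i\|a)^{\lambda_j+n-j}\big]_{i,j=1}^n}{\prod_{1\leqslant i<j\leqslant n}(x_i-x_j)},\qquad (x_i\|a)^r=(x_i-a_n)(x_i-a_{n-1})\cdots(x_i-a_{n-r+1}),\ (x_i\|a)^0=1,$$ and $0$ if $\ell(\lambda)>n$.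 This sequence is $s_\lambda(x\|a)\in\Lambda(x\|a)$. Supersymmetric functions: $\Lambda(x/y\|a)$ is the ring generated over $\mathbb Q[a]$ by $p_k(x/y)=\sum_{i\geqslant 1}\big(x_i^k+(-1)^{k-1}y_i^k\big)$, $k\geqslant 1$. The evaluation $y_i\mapsto -a_i$ sends $p_k(x/y)$ to $p_k(x\|a)$ and defines a ring isomorphism $\Lambda(x/y\|a)\to\Lambda(x\|a)$. Supersymmetric Schur functions: for $x=(x_1,\dots,x_n)$, $y=(y_1,\dots,y_n)$ and a skew diagram $\nu/\mu$ set $$s_{\nu/\mu}(x/y\|a)=\sum_{\mu\subseteq\rho\subseteq\nu}\widetilde s_{\nu/\rho}(x\|a)\,s_{\rho'/\mu'}(y\,|\,{ - }a),$$ where $\widetilde s_\theta(x\|a)=\sum_T\prod_{\alpha\in\theta}(x_{T(\alpha)}-a_{T(\alpha)-c(\alpha)})$ over reverse $\theta$-tableaux $T$ with entries in $\{1,\dots,n\}$ (weakly decreasing along rows, strictly decreasing down columns), and $s_\theta(y\,|\,{ - }a)=\sum_T\prod_{\alpha\in\theta}(y_{T(\alpha)}+a_{T(\alpha)+c(\alpha)})$ over semistandard $\theta$-tableaux $T$ with entries in $\{1,\dots,n\}$ (weakly increasing along rows, strictly increasing down columns). Here $c(\alpha)=j-i$ for the box $\alpha=(i,j)$ in row $i$, column $j$, and primes denote conjugate diagrams. These polynomials are consistent with the evaluations $x_n=y_n=0$ and so define elements $s_{\nu/\mu}(x/y\|a)\in\Lambda(x/y\|a)$ in infinitely many variables; $s_\nu=s_{\nu/\varnothing}$.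 -}

module Defs where

open import Algebra.Bundles using (CommutativeRing)
open import Algebra.Definitions.RawMonoid using () renaming (sum to fold)
open import Algebra.Morphism.Structures using (IsRingHomomorphism)
import Algebra.Apartness.Properties.HeytingCommutativeRing as Apartness
import Algebra.Properties.Ring as RingProperties
import Algebra.Properties.Semiring.Exp as Exp
open import Data.Bool.Base using (if_then_else_; true; false)
open import Data.Fin.Base as Fin using (Fin; zero; suc; toℕ; punchIn)
import Data.Fin.Properties as Fin
open import Data.Integer.Base as ℤ using (ℤ; +_; _⊖_)
open import Data.List.Base
  using (List; []; _∷_; length; lookup; map; concatMap; filter; foldr; upTo; allFin)
open import Data.List.Relation.Unary.All using (All; all?)
open import Data.List.Relation.Unary.Linked using (Linked; linked?)
open import Data.Nat.Base as ℕ using (ℕ; zero; suc; _∸_; _≤_; _<_; _≥_)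
open import Data.Nat.Coprimality using (1-coprimeTo) renaming (sym to coprime-sym)
import Data.Nat.Properties as ℕ
open import Data.Product.Base using (_×_; _,_; proj₁; proj₂; swap)
open import Data.Rational.Base using (ℚ; mkℚ; 0ℚ; 1ℚ)
import Data.Rational.Properties as ℚ
open import Function.Base using (id; flip; _∘_)
open import Level using (0ℓ)
open import Relation.Binary.Core using (Rel)
open import Relation.Binary.Definitions using (Decidable)
open import Relation.Binary.PropositionalEquality as ≡ using (_≡_; _≢_)
import Relation.Binary.Reasoning.Setoid as SetoidReasoning
open import Relation.Nullary.Decidable using (Dec; does; yes; no; _→-dec_; _×-dec_)
open import Relation.Nullary.Negation using (¬_)

------------------------------------------------------------------------
-- Polynomial rings

-- R [ V ] is the free commutative R-algebra on V: terms modulo the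
-- congruence generated by the commutative ring axioms and the requirement
-- that con be a ring homomorphism.

module _ (R : CommutativeRing 0ℓ 0ℓ) (V : Set) where

  private module R = CommutativeRing R

  infix  8 :-_
  infixl 7 _:*_
  infixl 6 _:+_

  data Poly : Set where
    con  : R.Carrier → Poly
    var  : V → Poly
    _:+_ : Poly → Poly → Poly
    _:*_ : Poly → Poly → Poly
    :-_  : Poly → Poly

module _ {R : CommutativeRing 0ℓ 0ℓ} {V : Set} where

  private module R = CommutativeRing R

  infix 4 _≈ₚ_

  data _≈ₚ_ : Rel (Poly R V) 0ℓ where
    ≈-refl       : ∀ {p} → p ≈ₚ p
    ≈-sym        : ∀ {p q} → p ≈ₚ q → q ≈ₚ p
    ≈-trans      : ∀ {p q r} → p ≈ₚ q → q ≈ₚ r → p ≈ₚ r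
    con-cong     : ∀ {a b} → a R.≈ b → con a ≈ₚ con b
    con-+        : ∀ a b → con (a R.+ b) ≈ₚ con a :+ con b
    con-*        : ∀ a b → con (a R.* b) ≈ₚ con a :* con b
    con--        : ∀ a → con (R.- a) ≈ₚ :- con a
    +-congₚ      : ∀ {p p′ q q′} → p ≈ₚ p′ → q ≈ₚ q′ → p :+ q ≈ₚ p′ :+ q′
    *-congₚ      : ∀ {p p′ q q′} → p ≈ₚ p′ → q ≈ₚ q′ → p :* q ≈ₚ p′ :* q′
    neg-congₚ    : ∀ {p p′} → p ≈ₚ p′ → :- p ≈ₚ :- p′
    +-assocₚ     : ∀ p q r → (p :+ q) :+ r ≈ₚ p :+ (q :+ r)
    +-commₚ      : ∀ p q → p :+ q ≈ₚ q :+ p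
    +-identityˡₚ : ∀ p → con R.0# :+ p ≈ₚ p
    +-inverseˡₚ  : ∀ p → (:- p) :+ p ≈ₚ con R.0#
    *-assocₚ     : ∀ p q r → (p :* q) :* r ≈ₚ p :* (q :* r)
    *-commₚ      : ∀ p q → p :* q ≈ₚ q :* p
    *-identityˡₚ : ∀ p → con R.1# :* p ≈ₚ p
    distribˡₚ    : ∀ p q r → p :* (q :+ r) ≈ₚ p :* q :+ p :* r

infix 9 _[_]

_[_] : CommutativeRing 0ℓ 0ℓ → Set → CommutativeRing 0ℓ 0ℓ
R [ V ] = record
  { Carrier = Poly R V
  ; _≈_     = _≈ₚ_
  ; _+_     = _:+_
  ; _*_     = _:*_
  ; -_      = :-_
  ; 0#      = con R.0#
  ; 1#      = con R.1#
  ; isCommutativeRing = record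
    { isRing = record
      { +-isAbelianGroup = record
        { isGroup = record
          { isMonoid = record
            { isSemigroup = record
              { isMagma = record
                { isEquivalence = record
                  { refl = ≈-refl ; sym = ≈-sym ; trans = ≈-trans }
                ; ∙-cong = +-congₚ
                }
              ; assoc = +-assocₚ
              }
            ; identity = +-identityˡₚ
                       , λ p → ≈-trans (+-commₚ p _) (+-identityˡₚ p)
            }
          ; inverse = +-inverseˡₚ
                    , λ p → ≈-trans (+-commₚ p _) (+-inverseˡₚ p)
          ; ⁻¹-cong = neg-congₚ
          }
        ; comm = +-commₚ
        }
      ; *-cong     = *-congₚ
      ; *-assoc    = *-assocₚ
      ; *-identity = *-identityˡₚ
                   , λ p → ≈-trans (*-commₚ p _) (*-identityˡₚ p)
      ; distrib    = distribˡₚ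
                   , λ p q r → ≈-trans (*-commₚ _ p)
                       (≈-trans (distribˡₚ p q r) (+-congₚ (*-commₚ p q) (*-commₚ p r)))
      }
    ; *-comm = *-commₚ
    }
  }
  where module R = CommutativeRing R

-- Ring homomorphisms and the universal property of R [ V ].

IsHom : (R S : CommutativeRing 0ℓ 0ℓ) →
        (CommutativeRing.Carrier R → CommutativeRing.Carrier S) → Set
IsHom R S = IsRingHomomorphism (CommutativeRing.rawRing R) (CommutativeRing.rawRing S)

module _ (R S : CommutativeRing 0ℓ 0ℓ) where

  private
    module R = CommutativeRing R
    module S = CommutativeRing S

  mkIsHom : {h : R.Carrier → S.Carrier} →
            (∀ {x y} → x R.≈ y → h x S.≈ h y) →
            (∀ x y → h (x R.+ y) S.≈ h x S.+ h y) →
            (∀ x y → h (x R.* y) S.≈ h x S.* h y) →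
            (∀ x → h (R.- x) S.≈ S.- h x) →
            h R.0# S.≈ S.0# → h R.1# S.≈ S.1# → IsHom R S h
  mkIsHom h-cong h-+ h-* h-- h-0 h-1 = record
    { isSemiringHomomorphism = record
      { isNearSemiringHomomorphism = record
        { +-isMonoidHomomorphism = record
          { isMagmaHomomorphism = record
            { isRelHomomorphism = record { cong = h-cong }
            ; homo = h-+
            }
          ; ε-homo = h-0
          }
        ; *-homo = h-*
        }
      ; 1#-homo = h-1
      }
    ; -‿homo = h--
    }

module _ (R S : CommutativeRing 0ℓ 0ℓ) where

  private
    module R = CommutativeRing R
    module S = CommutativeRing S

  module _ {V : Set} (h : R.Carrier → S.Carrier) (ρ : V → S.Carrier) where

    eval : Poly R V → S.Carrier
    eval (con c)  = h c
    eval (var v)  = ρ v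
    eval (p :+ q) = eval p S.+ eval q
    eval (p :* q) = eval p S.* eval q
    eval (:- p)   = S.- eval p

    module _ (h-isHom : IsHom R S h) where

      private module h = IsRingHomomorphism h-isHom

      eval-cong : ∀ {p q} → p ≈ₚ q → eval p S.≈ eval q
      eval-cong ≈-refl             = S.refl
      eval-cong (≈-sym e)          = S.sym (eval-cong e)
      eval-cong (≈-trans e f)      = S.trans (eval-cong e) (eval-cong f)
      eval-cong (con-cong e)       = h.⟦⟧-cong e
      eval-cong (con-+ a b)        = h.+-homo a b
      eval-cong (con-* a b)        = h.*-homo a b
      eval-cong (con-- a)          = h.-‿homo a
      eval-cong (+-congₚ e f)      = S.+-cong (eval-cong e) (eval-cong f)
      eval-cong (*-congₚ e f)      = S.*-cong (eval-cong e) (eval-cong f)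
      eval-cong (neg-congₚ e)      = S.-‿cong (eval-cong e)
      eval-cong (+-assocₚ p q r)   = S.+-assoc _ _ _
      eval-cong (+-commₚ p q)      = S.+-comm _ _
      eval-cong (+-identityˡₚ p)   = S.trans (S.+-congʳ h.0#-homo) (S.+-identityˡ _)
      eval-cong (+-inverseˡₚ p)    = S.trans (S.-‿inverseˡ _) (S.sym h.0#-homo)
      eval-cong (*-assocₚ p q r)   = S.*-assoc _ _ _
      eval-cong (*-commₚ p q)      = S.*-comm _ _
      eval-cong (*-identityˡₚ p)   = S.trans (S.*-congʳ h.1#-homo) (S.*-identityˡ _)
      eval-cong (distribˡₚ p q r)  = S.distribˡ _ _ _

      eval-isHom : IsHom (R [ V ]) S eval
      eval-isHom = mkIsHom (R [ V ]) S eval-cong (λ _ _ → S.refl) (λ _ _ → S.refl)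
                     (λ _ → S.refl) h.0#-homo h.1#-homo

con-isHom : ∀ R V → IsHom R (R [ V ]) con
con-isHom R V = mkIsHom R (R [ V ]) con-cong con-+ con-* con-- ≈-refl ≈-refl

------------------------------------------------------------------------
-- Sums, products, determinants and fractions over a commutative ring

module RingOps (R : CommutativeRing 0ℓ 0ℓ) where

  open CommutativeRing R hiding (zero)
  open Exp semiring using (_^_)

  ∑ : ∀ {n} → (Fin n → Carrier) → Carrier
  ∑ = fold +-rawMonoid

  ∏ : ∀ {n} → (Fin n → Carrier) → Carrier
  ∏ = fold *-rawMonoid

  ∑ₗ : {A : Set} → List A → (A → Carrier) → Carrier
  ∑ₗ xs f = foldr _+_ 0# (map f xs)

  ∏ₗ : {A : Set} → List A → (A → Carrier) → Carrier
  ∏ₗ xs f = foldr _*_ 1# (map f xs)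

  -- Laplace expansion along the first row.
  det : ∀ {n} → (Fin n → Fin n → Carrier) → Carrier
  det {zero}  M = 1#
  det {suc n} M =
    ∑ λ j → (- 1#) ^ toℕ j * (M zero j * det λ r c → M (suc r) (punchIn j c))

  vandermonde : ∀ {n} → (Fin n → Carrier) → Carrier
  vandermonde x = ∏ λ i → ∏ λ j → if does (i Fin.<? j) then x i - x j else 1#

-- Elements of the field of fractions (R is meant to be an integral domain).
record Fraction (R : CommutativeRing 0ℓ 0ℓ) : Set where
  constructor _/_⟨_⟩
  open CommutativeRing R using (Carrier; _≈_; 0#)
  field
    num   : Carrier
    den   : Carrier
    den≉0 : ¬ den ≈ 0#

infix 4 _≃_

_≃_ : ∀ {R} → Rel (Fraction R) 0ℓ
_≃_ {R} (p / q ⟨ _ ⟩) (r / s ⟨ _ ⟩) = p * s ≈ r * q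
  where open CommutativeRing R

------------------------------------------------------------------------
-- ℚ[a] and the polynomial rings over it

ℚ[a] : CommutativeRing 0ℓ 0ℓ
ℚ[a] = ℚ.+-*-commutativeRing [ ℤ ]

a : ℤ → CommutativeRing.Carrier ℚ[a]
a = var

data XY (n : ℕ) : Set where
  x y : Fin n → XY n

ℚ[a][x] ℚ[a][x/y] : ℕ → CommutativeRing 0ℓ 0ℓ
ℚ[a][x]   n = ℚ[a] [ Fin n ]
ℚ[a][x/y] n = ℚ[a] [ XY n ]

-- The variables x₁,…,xₙ are indexed by Fin n, which starts at 0.
index : ∀ {n} → Fin n → ℤ
index i = + suc (toℕ i)

-- Families (Pₙ)ₙ of polynomials, with n ≥ 0 variables x and in the second
-- case also n variables y.  Elements of Λ(x‖a) and Λ(x/y‖a) are given by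
-- such families, and are equal when all the components are.
Seq[x] Seq[x/y] : Set
Seq[x]   = ∀ n → CommutativeRing.Carrier (ℚ[a][x] n)
Seq[x/y] = ∀ n → CommutativeRing.Carrier (ℚ[a][x/y] n)

-- In every component: the homomorphism of ℚ[a]-algebras xᵢ ↦ xᵢ, yᵢ ↦ -aᵢ.
evaluate-y=-aₙ : ∀ n → CommutativeRing.Carrier (ℚ[a][x/y] n) →
                       CommutativeRing.Carrier (ℚ[a][x] n)
evaluate-y=-aₙ n = eval ℚ[a] (ℚ[a][x] n) con image
  where
  open CommutativeRing (ℚ[a][x] n)
  image : XY n → Carrier
  image (x i) = var i
  image (y i) = - con (a (index i))

infix 10 _∣y=-a

_∣y=-a : Seq[x/y] → Seq[x]
(F ∣y=-a) n = evaluate-y=-aₙ n (F n)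

-- pₖ(x/y) and pₖ(x‖a) for k = suc m.
p[x/y] : ℕ → Seq[x/y]
p[x/y] m n = ∑ λ i → var (x i) ^ suc m + (- 1#) ^ m * var (y i) ^ suc m
  where
  open CommutativeRing (ℚ[a][x/y] n)
  open Exp semiring using (_^_)
  open RingOps (ℚ[a][x/y] n)

p[x‖a] : ℕ → Seq[x]
p[x‖a] m n = ∑ λ i → var i ^ suc m - con (a (index i)) ^ suc m
  where
  open CommutativeRing (ℚ[a][x] n)
  open Exp semiring using (_^_)
  open RingOps (ℚ[a][x] n)

module _ (R S : CommutativeRing 0ℓ 0ℓ) where

  private
    module R where
      open CommutativeRing R public
      open Exp semiring public using (_^_)
      open RingOps R public
    module S where
      open CommutativeRing S public
      open Exp semiring public using (_^_; ^-congˡ)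
      open RingOps S public

  module _ {h : R.Carrier → S.Carrier} (h-isHom : IsHom R S h) where

    private module h = IsRingHomomorphism h-isHom

    hom-∑ : ∀ {n} (f : Fin n → R.Carrier) (g : Fin n → S.Carrier) →
            (∀ i → h (f i) S.≈ g i) → h (R.∑ f) S.≈ S.∑ g
    hom-∑ {zero}  f g e = h.0#-homo
    hom-∑ {suc n} f g e =
      S.trans (h.+-homo _ _) (S.+-cong (e zero) (hom-∑ (f ∘ suc) (g ∘ suc) (e ∘ suc)))

    hom-∏ : ∀ {n} (f : Fin n → R.Carrier) (g : Fin n → S.Carrier) →
            (∀ i → h (f i) S.≈ g i) → h (R.∏ f) S.≈ S.∏ g
    hom-∏ {zero}  f g e = h.1#-homo
    hom-∏ {suc n} f g e =
      S.trans (h.*-homo _ _) (S.*-cong (e zero) (hom-∏ (f ∘ suc) (g ∘ suc) (e ∘ suc)))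

    hom-^ : ∀ r k → h (r R.^ k) S.≈ h r S.^ k
    hom-^ r zero    = h.1#-homo
    hom-^ r (suc k) = S.trans (h.*-homo _ _) (S.*-congˡ (hom-^ r k))

    hom-vandermonde : ∀ {n} (f : Fin n → R.Carrier) →
                      h (R.vandermonde f) S.≈ S.vandermonde (h ∘ f)
    hom-vandermonde f = hom-∏ _ _ λ i → hom-∏ _ _ λ j → factor i j
      where
      factor : ∀ i j →
        h (if does (i Fin.<? j) then f i R.- f j else R.1#) S.≈
        (if does (i Fin.<? j) then h (f i) S.- h (f j) else S.1#)
      factor i j with does (i Fin.<? j)
      ... | true  = S.trans (h.+-homo _ _) (S.+-congˡ (h.-‿homo _))
      ... | false = h.1#-homo

module _ (R : CommutativeRing 0ℓ 0ℓ) where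

  open CommutativeRing R hiding (zero)
  open RingProperties ring using (-‿involutive; -‿distribˡ-*; -‿distribʳ-*; -1*x≈-x)
  open Exp semiring using (_^_)
  open SetoidReasoning setoid

  sign-power : ∀ z m → (- 1#) ^ m * (- z) ^ suc m ≈ - (z ^ suc m)
  sign-power z zero = begin
    1# * (- z * 1#)  ≈⟨ *-identityˡ _ ⟩
    - z * 1#         ≈⟨ -‿distribˡ-* z 1# ⟨
    - (z * 1#)       ∎
  sign-power z (suc m) = begin
    (- 1# * s) * (- z * w)      ≈⟨ *-congʳ (-1*x≈-x s) ⟩
    - s * (- z * w)             ≈⟨ -‿distribˡ-* s _ ⟨
    - (s * (- z * w))           ≈⟨ -‿cong (*-congˡ (-‿distribˡ-* z w)) ⟨
    - (s * - (z * w))           ≈⟨ -‿cong (-‿distribʳ-* s _) ⟨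
    - - (s * (z * w))           ≈⟨ -‿involutive _ ⟩
    s * (z * w)                 ≈⟨ *-assoc s z w ⟨
    (s * z) * w                 ≈⟨ *-congʳ (*-comm s z) ⟩
    (z * s) * w                 ≈⟨ *-assoc z s w ⟩
    z * (s * w)                 ≈⟨ *-congˡ (sign-power z m) ⟩
    z * - (z ^ suc m)           ≈⟨ -‿distribʳ-* z _ ⟨
    - (z * z ^ suc m)           ∎
    where
    s = (- 1#) ^ m
    w = (- z) ^ suc m

-- So on the ring Λ(x/y‖a) generated over ℚ[a] by the pₖ(x/y), the evaluation
-- y = -a is the isomorphism onto Λ(x‖a) with pₖ(x/y) ↦ pₖ(x‖a).
module _ (n : ℕ) where

  private
    A = ℚ[a][x/y] n
    B = ℚ[a][x] n
    module B = CommutativeRing B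

  evaluate-isHom : IsHom A B (evaluate-y=-aₙ n)
  evaluate-isHom = eval-isHom ℚ[a] B con _ (con-isHom ℚ[a] (Fin n))

  evaluate-p : ∀ m → (p[x/y] m ∣y=-a) n B.≈ p[x‖a] m n
  evaluate-p m = hom-∑ A B evaluate-isHom _ _ λ i →
    B.+-cong (hom-^ A B evaluate-isHom (var (x i)) (suc m))
      (B.trans
        (B.*-cong (hom-^ A B evaluate-isHom (:- con (CommutativeRing.1# ℚ[a])) m)
                  (hom-^ A B evaluate-isHom (var (y i)) (suc m)))
        (sign-power B (con (a (index i))) m))

------------------------------------------------------------------------
-- Diagrams

record Partition : Set where
  field
    parts      : List ℕ
    decreasing : Linked _≥_ parts
    positive   : All (0 <_) parts

∅ : Partition
∅ = record { parts = [] ; decreasing = Linked.[] ; positive = All.[] }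

ℓ : Partition → ℕ
ℓ λ′ = length (Partition.parts λ′)

-- The i-th part, counting from 0, of the partition with the given parts.
part : List ℕ → ℕ → ℕ
part []       _       = 0
part (r ∷ _)  zero    = r
part (_ ∷ rs) (suc i) = part rs i

-- The box in row i and column j is (i , j); both are counted from 0.
Box : Set
Box = ℕ × ℕ

row col : Box → ℕ
row = proj₁
col = proj₂

Diagram : Set
Diagram = List Box

content : Box → ℤ
content (i , j) = j ⊖ i

skew : List ℕ → List ℕ → Diagram
skew ν μ = concatMap
  (λ i → map (i ,_) (filter (part μ i ℕ.≤?_) (upTo (part ν i))))
  (upTo (length ν))

conjugate : Diagram → Diagram
conjugate = map swap

_⊆_ : List ℕ → List ℕ → Set
μ ⊆ ρ = ∀ (i : Fin (length μ)) → lookup μ i ≤ part ρ (toℕ i)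

_⊆?_ : Decidable _⊆_
μ ⊆? ρ = Fin.all? λ i → lookup μ i ℕ.≤? part ρ (toℕ i)

-- Lists ρ of positive integers with length ρ ≤ length ν and ρᵢ ≤ νᵢ.
bounded : List ℕ → List (List ℕ)
bounded []       = [] ∷ []
bounded (k ∷ ks) = [] ∷ concatMap (λ r → map (suc r ∷_) (bounded ks)) (upTo k)

between : (μ ν : List ℕ) → List (List ℕ)
between μ ν = filter (μ ⊆?_) (filter (linked? ℕ._≥?_) (bounded ν))

------------------------------------------------------------------------
-- Tableaux

Filling : ℕ → Set
Filling n = List (Box × Fin n)

fillings : ∀ n → Diagram → List (Filling n)
fillings n []      = [] ∷ []
fillings n (α ∷ θ) = concatMap (λ t → map ((α , t) ∷_) (fillings n θ)) (allFin n)

-- R holds from left to right along rows, S from top to bottom down columns.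
module _ {n} (R S : Rel (Fin n) 0ℓ) where

  Compatible : Rel (Box × Fin n) 0ℓ
  Compatible (α , s) (β , t) =
    (row α ≡ row β → col α < col β → R s t) ×
    (col α ≡ col β → row α < row β → S s t)

  IsTableau : Filling n → Set
  IsTableau T = All (λ u → All (Compatible u) T) T

  isTableau? : Decidable R → Decidable S → ∀ T → Dec (IsTableau T)
  isTableau? R? S? T = all? (λ u → all? (compatible? u) T) T
    where
    compatible? : Decidable Compatible
    compatible? (α , s) (β , t) =
      ((row α ℕ.≟ row β) →-dec (col α ℕ.<? col β) →-dec R? s t) ×-dec
      ((col α ℕ.≟ col β) →-dec (row α ℕ.<? row β) →-dec S? s t)

semistandard : ∀ n → Diagram → List (Filling n)
semistandard n θ = filter (isTableau? Fin._≤_ Fin._<_ Fin._≤?_ Fin._<?_) (fillings n θ)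

reverseTableaux : ∀ n → Diagram → List (Filling n)
reverseTableaux n θ =
  filter (isTableau? Fin._≥_ Fin._>_ (flip Fin._≤?_) (flip Fin._<?_)) (fillings n θ)

------------------------------------------------------------------------
-- Supersymmetric Schur functions

module _ (n : ℕ) where

  open CommutativeRing (ℚ[a][x/y] n)
  open RingOps (ℚ[a][x/y] n)

  -- s̃_θ(x‖a)
  s̃ : Diagram → Carrier
  s̃ θ = ∑ₗ (reverseTableaux n θ) λ T → ∏ₗ T λ (α , t) →
    var (x t) - con (a (index t ℤ.- content α))

  -- s_θ(y|-a)
  s[y∣-a] : Diagram → Carrier
  s[y∣-a] θ = ∑ₗ (semistandard n θ) λ T → ∏ₗ T λ (α , t) →
    var (y t) + con (a (index t ℤ.+ content α))

  superSchurₙ : (ν μ : List ℕ) → Carrier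
  superSchurₙ ν μ = ∑ₗ (between μ ν) λ ρ →
    s̃ (skew ν ρ) * s[y∣-a] (conjugate (skew ρ μ))

-- s_{ν/μ}(x/y‖a)
skewSuperSchur : Partition → Partition → Seq[x/y]
skewSuperSchur ν μ n = superSchurₙ n (Partition.parts ν) (Partition.parts μ)

-- s_ν(x/y‖a)
superSchur : Partition → Seq[x/y]
superSchur ν = skewSuperSchur ν ∅

------------------------------------------------------------------------
-- Double Schur functions

-- The Vandermonde product is nonzero, as seen by putting aᵢ = 0 and xᵢ = i.
module _ where

  private
    module ℚ# = Apartness ℚ.heytingCommutativeRing
    module ℚR where
      open CommutativeRing ℚ.+-*-commutativeRing public
      open RingOps ℚ.+-*-commutativeRing public

  fromℕ : ℕ → ℚ
  fromℕ k = mkℚ (+ k) 0 (coprime-sym (1-coprimeTo k))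

  fromℕ-injective : ∀ {k l} → fromℕ k ≡ fromℕ l → k ≡ l
  fromℕ-injective ≡.refl = ≡.refl

  ∏≢0 : ∀ {n} (f : Fin n → ℚ) → (∀ i → f i ≢ 0ℚ) → ℚR.∏ f ≢ 0ℚ
  ∏≢0 {zero}  f f≢0 = λ ()
  ∏≢0 {suc n} f f≢0 = ℚ#.x#0y#0→xy#0 (f≢0 zero) (∏≢0 (f ∘ suc) (f≢0 ∘ suc))

  vandermonde-ℚ≢0 : ∀ n → ℚR.vandermonde {n} (fromℕ ∘ toℕ) ≢ 0ℚ
  vandermonde-ℚ≢0 n = ∏≢0 _ λ i → ∏≢0 _ λ j → factor i j (i Fin.<? j)
    where
    factor : ∀ (i j : Fin n) (i<?j : Dec (i Fin.< j)) →
      (if does i<?j then fromℕ (toℕ i) ℚR.- fromℕ (toℕ j) else 1ℚ) ≢ 0ℚ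
    factor i j (no _)    = λ ()
    factor i j (yes i<j) = λ e → ℕ.<⇒≢ i<j (fromℕ-injective
                             (RingProperties.x∙y⁻¹≈ε⇒x≈y ℚR.ring _ _ e))

  ℚ[a]→ℚ : CommutativeRing.Carrier ℚ[a] → ℚ
  ℚ[a]→ℚ = eval ℚ.+-*-commutativeRing ℚ.+-*-commutativeRing id (λ _ → 0ℚ)

  ℚ[a]→ℚ-isHom : IsHom ℚ[a] ℚ.+-*-commutativeRing ℚ[a]→ℚ
  ℚ[a]→ℚ-isHom = eval-isHom Q Q id (λ _ → 0ℚ)
    (mkIsHom Q Q id (λ _ _ → ≡.refl) (λ _ _ → ≡.refl) (λ _ → ≡.refl) ≡.refl ≡.refl)
    where Q = ℚ.+-*-commutativeRing

  vandermonde≉0 : ∀ n → let open CommutativeRing (ℚ[a][x] n) in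
                  ¬ RingOps.vandermonde (ℚ[a][x] n) var ≈ 0#
  vandermonde≉0 n e = vandermonde-ℚ≢0 n
    (≡.trans (≡.sym (hom-vandermonde (ℚ[a][x] n) ℚ.+-*-commutativeRing h-isHom var)) (IsRingHomomorphism.⟦⟧-cong h-isHom e))
    where
    h-isHom : IsHom (ℚ[a][x] n) ℚ.+-*-commutativeRing 
                    (eval ℚ[a] ℚ.+-*-commutativeRing ℚ[a]→ℚ (fromℕ ∘ toℕ))
    h-isHom = eval-isHom ℚ[a] ℚ.+-*-commutativeRing _ _ ℚ[a]→ℚ-isHom

module _ (n : ℕ) where

  open CommutativeRing (ℚ[a][x] n)
  open RingOps (ℚ[a][x] n)

  -- (z‖a)^r = (z - aₙ)(z - aₙ₋₁)⋯(z - aₙ₋ᵣ₊₁)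
  ⟨_‖a⟩^_ : Carrier → ℕ → Carrier
  ⟨ z ‖a⟩^ r = ∏ {r} λ k → z - con (a (n ⊖ toℕ k))

  1≉0 : ¬ 1# ≈ 0#
  1≉0 e = ℚ.1≢0 (eval-cong ℚ[a] ℚ.+-*-commutativeRing _ (λ _ → 0ℚ) ℚ[a]→ℚ-isHom e)

  toFraction : Carrier → Fraction (ℚ[a][x] n)
  toFraction p = p / 1# ⟨ 1≉0 ⟩

-- s_ν(x₁,…,xₙ‖a).  As j : Fin n counts from 0, the exponent λⱼ + n - j of the
-- usual indexing becomes part parts j + (n ∸ suc j).
doubleSchur : Partition → ∀ n → Fraction (ℚ[a][x] n)
doubleSchur ν n with ℓ ν ℕ.≤? n
... | no  _ = toFraction n 0#
  where open CommutativeRing (ℚ[a][x] n)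
... | yes _ =
  det (λ i j → ⟨_‖a⟩^_ n (var i) (part (Partition.parts ν) (toℕ j) ℕ.+ (n ∸ suc (toℕ j))))
  / vandermonde var ⟨ vandermonde≉0 n ⟩
  where open RingOps (ℚ[a][x] n)

-- A sequence of polynomials equals a sequence of fractions.
infix 4 _≋_

_≋_ : Seq[x] → (∀ n → Fraction (ℚ[a][x] n)) → Set
P ≋ Q = ∀ n → toFraction n (P n) ≃ Q n

{-# OPTIONS --safe #-}
module Submission where

-- Putting yₜ = -aₜ kills s_{ρ'}(y|-a) for ρ ≠ ∅, since the box with content 0
-- contributes the factor yₜ + aₜ.  Only s̃_ν(x‖a) is left, and it remains to
-- identify this sum over reverse tableaux with a quotient of determinants.
--
-- This goes by induction on n.  The entries 1 of a reverse ν-tableau fill the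
-- boxes outside a diagram μ interlacing with ν, and the rest is a reverse
-- μ-tableau in x₂,…,xₙ.  On the determinant side, subtracting from each column
-- a multiple of the next one clears the first row up to its last entry, and
-- each entry of the remaining minor is a telescoping sum which carries the
-- factor x₁ - xᵢ; expanding the columns gives the same sum over μ.  The
-- sequence k ↦ aₙ₋ₖ is the same for (x₁,…,xₙ) and for (x₂,…,xₙ) with a shifted.

open import Defs
open import Algebra.Bundles using (CommutativeRing)
open import Algebra.Morphism.Structures using (IsRingHomomorphism)
import Algebra.Properties.Ring as RingProperties
import Algebra.Properties.Semiring.Exp as Exp
import Algebra.Solver.Ring.NaturalCoefficients.Default as SemiringSolver
open import Data.Bool.Base using (if_then_else_; true; false)
open import Data.Empty using (⊥-elim)
open import Data.Fin.Base as Fin using (Fin; zero; suc; toℕ; punchIn)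
import Data.Fin.Properties as Fin
open import Data.Integer.Base as ℤ using (ℤ; +_; _⊖_)
import Data.Integer.Properties as ℤ
open import Data.List.Base as List using (List; []; _∷_; _++_; length)
import Data.List.Properties as List
open import Data.List.Membership.Propositional using (_∈_)
open import Data.List.Membership.Propositional.Properties
  using (∈-++⁺ˡ; ∈-++⁺ʳ; ∈-++⁻; ∈-map⁺; ∈-map⁻)
open import Data.List.Relation.Binary.Permutation.Propositional as Perm
  using (_↭_; ↭-sym; prep; swap)
import Data.List.Relation.Binary.Permutation.Propositional.Properties as Perm
open import Data.List.Relation.Ternary.Interleaving.Propositional
  using (Interleaving; []; consˡ; consʳ; toPermutation)
open import Data.List.Relation.Unary.All as All using (All; []; _∷_)
import Data.List.Relation.Unary.All.Properties as All
open import Data.List.Relation.Unary.Any using (here; there)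
open import Data.List.Relation.Unary.Linked using (Linked; []; [-]; _∷_)
open import Data.Nat.Base as ℕ using (ℕ; zero; suc; _∸_; _≤_; _<_; _≥_; z≤n; s≤s)
import Data.Nat.Properties as ℕ
open import Data.Product.Base as Product using (_×_; _,_; proj₁; proj₂; ∃-syntax)
open import Data.Sum.Base using (_⊎_; inj₁; inj₂)
open import Data.Vec.Base as Vec using (Vec; []; _∷_; tabulate; toList)
import Data.Vec.Properties as Vec
open import Data.Vec.Relation.Binary.Pointwise.Inductive using (Pointwise; []; _∷_; tabulate⁺)
open import Function.Base using (_∘_; flip; id)
open import Level using (0ℓ)
open import Relation.Binary.PropositionalEquality as ≡ using (_≡_)
import Relation.Binary.Reasoning.Setoid as SetoidReasoning
open import Relation.Nullary.Decidable using (Dec; does; yes; no)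
open import Relation.Nullary.Negation using (¬_)

-- Determinants as functions of the columns

-- No division ever takes place: each identity carries the Vandermonde product, or the product of
-- the x₁ - xᵢ, as a factor, which is also the form that equality of fractions asks for. The
-- induction stays inside one fixed commutative ring and treats the variables as a family `X` of its
-- elements, so passing to x₂,...,xₙ is composition with `suc` and not a change of polynomial ring.
-- Diagrams are padded with empty rows to n rows. Removing the entries 1 then leaves a diagram that
-- still has n rows but must be filled with n - 1 values; if its last row is nonempty, its first
-- column is too long and the contribution is 0. The remaining diagrams have n - 1 rows, one for
-- each column of the minor. A filling is a list in the order of the boxes, and collecting its
-- smallest entries at the front reorders it. For this reason sums over tableaux are extended by
-- zero to all fillings, with summands invariant under permutation.

module Determinants (R : CommutativeRing 0ℓ 0ℓ) where

  open CommutativeRing R hiding (zero)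
  open RingOps R
  open Exp semiring using (_^_)
  open SetoidReasoning setoid
  open SemiringSolver commutativeSemiring
    using (solve; _:=_) renaming (_:+_ to _⊕_; _:*_ to _⊗_)

  ε : Carrier
  ε = - 1#

  z+εz≈0 : ∀ z → z + ε * z ≈ 0#
  z+εz≈0 z = begin
    z + ε * z ≈⟨ +-congˡ (RingProperties.-1*x≈-x ring z) ⟩
    z - z     ≈⟨ -‿inverseʳ z ⟩
    0#        ∎

  module _ {A : Set} (t : A → Carrier) where

    -- Expansion along the first row as a recursion on the list of columns: `t` reads the entry in
    -- that row, and `F` is the minor as a function of the columns left over. The terms that keep
    -- `c` change only `F`, to `F ∘ (c ∷_)`, so inductions have to run over arbitrary `F`.
    laplace : ∀ {n} → (Vec A n → Carrier) → Vec A (suc n) → Carrier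
    laplace {zero}  F (c ∷ []) = t c * F []
    laplace {suc n} F (c ∷ cs) = t c * F cs + ε * laplace (F ∘ (c ∷_)) cs

    -- When the first column is a combination, `F ∘ (c ∷_)` becomes one of `F ∘ (d ∷_)` and
    -- `F ∘ (e ∷_)`. The terms keeping that column need linearity in this form.
    laplace-linear : ∀ {n} {F G H : Vec A n → Carrier} {s s′} →
      (∀ cs → F cs ≈ s * G cs + s′ * H cs) →
      ∀ cs → laplace F cs ≈ s * laplace G cs + s′ * laplace H cs
    laplace-linear {zero} {F} {G} {H} {s} {s′} e (c ∷ []) = begin
      t c * F []                        ≈⟨ *-congˡ (e []) ⟩
      t c * (s * G [] + s′ * H [])
        ≈⟨ solve 5 (λ u p g q h → u ⊗ (p ⊗ g ⊕ q ⊗ h) := p ⊗ (u ⊗ g) ⊕ q ⊗ (u ⊗ h))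
             refl (t c) s (G []) s′ (H []) ⟩
      s * (t c * G []) + s′ * (t c * H []) ∎
    laplace-linear {suc n} {F} {G} {H} {s} {s′} e (c ∷ cs) = begin
      t c * F cs + ε * laplace (F ∘ (c ∷_)) cs
        ≈⟨ +-cong (*-congˡ (e cs)) (*-congˡ (laplace-linear (e ∘ (c ∷_)) cs)) ⟩
      t c * (s * G cs + s′ * H cs) + ε * (s * LG + s′ * LH)
        ≈⟨ solve 8 (λ u p g q h m k l →
             u ⊗ (p ⊗ g ⊕ q ⊗ h) ⊕ m ⊗ (p ⊗ k ⊕ q ⊗ l) :=
             p ⊗ (u ⊗ g ⊕ m ⊗ k) ⊕ q ⊗ (u ⊗ h ⊕ m ⊗ l))
             refl (t c) s (G cs) s′ (H cs) ε LG LH ⟩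
      s * (t c * G cs + ε * LG) + s′ * (t c * H cs + ε * LH) ∎
      where
      LG = laplace (G ∘ (c ∷_)) cs
      LH = laplace (H ∘ (c ∷_)) cs

    laplace-zero : ∀ {n} {F : Vec A n → Carrier} → (∀ cs → F cs ≈ 0#) →
                   ∀ cs → laplace F cs ≈ 0#
    laplace-zero {zero}  F≈0 (c ∷ []) = trans (*-congˡ (F≈0 [])) (zeroʳ _)
    laplace-zero {suc n} F≈0 (c ∷ cs) = begin
      t c * _ + ε * _   ≈⟨ +-cong (*-congˡ (F≈0 cs)) (*-congˡ (laplace-zero (F≈0 ∘ (c ∷_)) cs)) ⟩
      t c * 0# + ε * 0# ≈⟨ +-cong (zeroʳ _) (zeroʳ _) ⟩
      0# + 0#           ≈⟨ +-identityˡ 0# ⟩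
      0#                ∎

    laplace-tabulate : ∀ {n} (F : Vec A n → Carrier) (m : Fin (suc n) → A) →
      laplace F (tabulate m) ≈ ∑ λ j → ε ^ toℕ j * (t (m j) * F (tabulate (m ∘ punchIn j)))
    laplace-tabulate {zero} F m = begin
      t (m zero) * F []             ≈⟨ *-identityˡ _ ⟨
      1# * (t (m zero) * F [])      ≈⟨ +-identityʳ _ ⟨
      1# * (t (m zero) * F []) + 0# ∎
    laplace-tabulate {suc n} F m = +-cong (sym (*-identityˡ _)) (begin
      ε * laplace (F ∘ (m zero ∷_)) (tabulate (m ∘ suc))
        ≈⟨ *-congˡ (laplace-tabulate (F ∘ (m zero ∷_)) (m ∘ suc)) ⟩
      ε * ∑ (λ j → ε ^ toℕ j * term j)   ≈⟨ ε-∑ toℕ term ⟩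
      ∑ (λ j → ε ^ suc (toℕ j) * term j) ∎)
      where
      term : Fin (suc n) → Carrier
      term j = t (m (suc j)) * F (tabulate (m ∘ punchIn (suc j)))

      ε-∑ : ∀ {k} (e : Fin k → ℕ) (f : Fin k → Carrier) →
            ε * ∑ (λ j → ε ^ e j * f j) ≈ ∑ (λ j → ε ^ suc (e j) * f j)
      ε-∑ {zero}  e f = zeroʳ ε
      ε-∑ {suc k} e f = begin
        ε * (_ + _)   ≈⟨ distribˡ ε _ _ ⟩
        ε * _ + ε * _ ≈⟨ +-cong (sym (*-assoc ε _ _)) (ε-∑ (e ∘ suc) (f ∘ suc)) ⟩
        _ + _         ∎

  data Adjacent {A : Set} : ∀ {n} → Vec A n → Set where
    here  : ∀ {n c} {cs : Vec A n} → Adjacent (c ∷ c ∷ cs)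
    there : ∀ {n c} {cs : Vec A n} → Adjacent cs → Adjacent (c ∷ cs)

  Alternating : ∀ {A : Set} {n} → (Vec A n → Carrier) → Set
  Alternating F = ∀ {cs} → Adjacent cs → F cs ≈ 0#

  -- The two terms that remove one of the equal neighbours have the same minor and opposite signs.
  -- In every other term both neighbours survive and are still adjacent, so `F` vanishes.
  laplace-alternating : ∀ {A : Set} (t : A → Carrier) {n} {F : Vec A n → Carrier} →
                        Alternating F → Alternating (laplace t F)
  laplace-alternating t {suc zero} {F} alt {c ∷ c ∷ []} here = z+εz≈0 _
  laplace-alternating t {suc (suc n)} {F} alt {c ∷ c ∷ cs} here = begin
    t c * F (c ∷ cs) + ε * (t c * F (c ∷ cs) + ε * laplace t (λ ds → F (c ∷ c ∷ ds)) cs)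
      ≈⟨ +-congˡ (*-congˡ (trans (+-congˡ
           (trans (*-congˡ (laplace-zero t (λ _ → alt here) cs)) (zeroʳ ε))) (+-identityʳ _))) ⟩
    t c * F (c ∷ cs) + ε * (t c * F (c ∷ cs)) ≈⟨ z+εz≈0 _ ⟩
    0#                                        ∎
  laplace-alternating t {zero}  alt {c ∷ []} (there ())
  laplace-alternating t {suc n} {F} alt {c ∷ cs} (there adj) = begin
    t c * F cs + ε * laplace t (F ∘ (c ∷_)) cs
      ≈⟨ +-cong (*-congˡ (alt adj)) (*-congˡ (laplace-alternating t (alt ∘ there) adj)) ⟩
    t c * 0# + ε * 0# ≈⟨ +-cong (zeroʳ _) (zeroʳ _) ⟩
    0# + 0#           ≈⟨ +-identityˡ 0# ⟩
    0#                ∎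

  infix 4 _≗_

  _≗_ : {I : Set} → (I → Carrier) → (I → Carrier) → Set
  c ≗ d = ∀ i → c i ≈ d i

  -- A relation between whole vectors that differ in one column, rather than an index with an
  -- update: it passes under `F ∘ (c ∷_)` by `there`, and under deletion of the first row by
  -- mapping.
  data Combination {I : Set} (s s′ : Carrier) :
       ∀ {n} → (cs ds es : Vec (I → Carrier) n) → Set where
    here  : ∀ {n c d e} {cs : Vec (I → Carrier) n} → c ≗ (λ i → s * d i + s′ * e i) →
            Combination s s′ (c ∷ cs) (d ∷ cs) (e ∷ cs)
    there : ∀ {n c} {cs ds es : Vec (I → Carrier) n} → Combination s s′ cs ds es →
            Combination s s′ (c ∷ cs) (c ∷ ds) (c ∷ es)

  Linear : ∀ {I : Set} {n} → (Vec (I → Carrier) n → Carrier) → Set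
  Linear F = ∀ {s s′ cs ds es} → Combination s s′ cs ds es → F cs ≈ s * F ds + s′ * F es

  module _ {I : Set} {t : (I → Carrier) → Carrier}
    (t-linear : ∀ {s s′ c d e} → c ≗ (λ i → s * d i + s′ * e i) → t c ≈ s * t d + s′ * t e)
    where

    laplace-Linear : ∀ {n} {F : Vec (I → Carrier) n → Carrier} →
                     Linear F → Linear (laplace t F)
    laplace-Linear {zero} {F} lin {s} {s′} {c ∷ []} {d ∷ []} {e ∷ []} (here eq) = begin
      t c * F []                      ≈⟨ *-congʳ (t-linear eq) ⟩
      (s * t d + s′ * t e) * F []
        ≈⟨ solve 5 (λ p u q v f → (p ⊗ u ⊕ q ⊗ v) ⊗ f := p ⊗ (u ⊗ f) ⊕ q ⊗ (v ⊗ f))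
             refl s (t d) s′ (t e) (F []) ⟩
      s * (t d * F []) + s′ * (t e * F []) ∎
    laplace-Linear {zero} lin {cs = c ∷ []} (there ())
    laplace-Linear {suc n} {F} lin {s} {s′} {c ∷ cs} {d ∷ cs} {e ∷ cs} (here eq) = begin
      t c * F cs + ε * laplace t (F ∘ (c ∷_)) cs
        ≈⟨ +-cong (*-congʳ (t-linear eq)) (*-congˡ (laplace-linear t (λ _ → lin (here eq)) cs)) ⟩
      (s * t d + s′ * t e) * F cs + ε * (s * Ld + s′ * Le)
        ≈⟨ solve 8 (λ p u q v f m k l →
             (p ⊗ u ⊕ q ⊗ v) ⊗ f ⊕ m ⊗ (p ⊗ k ⊕ q ⊗ l) :=
             p ⊗ (u ⊗ f ⊕ m ⊗ k) ⊕ q ⊗ (v ⊗ f ⊕ m ⊗ l))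
             refl s (t d) s′ (t e) (F cs) ε Ld Le ⟩
      s * (t d * F cs + ε * Ld) + s′ * (t e * F cs + ε * Le) ∎
      where
      Ld = laplace t (F ∘ (d ∷_)) cs
      Le = laplace t (F ∘ (e ∷_)) cs
    laplace-Linear {suc n} {F} lin {s} {s′} {c ∷ cs} {c ∷ ds} {c ∷ es} (there comb) = begin
      t c * F cs + ε * laplace t (F ∘ (c ∷_)) cs
        ≈⟨ +-cong (*-congˡ (lin comb)) (*-congˡ (laplace-Linear (lin ∘ there) comb)) ⟩
      t c * (s * F ds + s′ * F es) + ε * (s * Ld + s′ * Le)
        ≈⟨ solve 8 (λ u p g q h m k l →
             u ⊗ (p ⊗ g ⊕ q ⊗ h) ⊕ m ⊗ (p ⊗ k ⊕ q ⊗ l) :=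
             p ⊗ (u ⊗ g ⊕ m ⊗ k) ⊕ q ⊗ (u ⊗ h ⊕ m ⊗ l))
             refl (t c) s (F ds) s′ (F es) ε Ld Le ⟩
      s * (t c * F ds + ε * Ld) + s′ * (t c * F es + ε * Le) ∎
      where
      Ld = laplace t (F ∘ (c ∷_)) ds
      Le = laplace t (F ∘ (c ∷_)) es

  -- Columns are functions, and pointwise equal ones need not be identical. But a column pointwise
  -- equal to `d` is the combination 1 · d + 0 · d, so linearity already implies congruence.
  Linear-cong : ∀ {I : Set} {n} {F : Vec (I → Carrier) n → Carrier} → Linear F →
                ∀ {cs ds} → Pointwise _≗_ cs ds → F cs ≈ F ds
  Linear-cong lin [] = refl
  Linear-cong {F = F} lin {c ∷ cs} {d ∷ ds} (c≗d ∷ cs≗ds) = begin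
    F (c ∷ cs) ≈⟨ lin (here λ i → trans (c≗d i) (sym (unit _))) ⟩
    1# * F (d ∷ cs) + 0# * F (d ∷ cs) ≈⟨ unit _ ⟩
    F (d ∷ cs) ≈⟨ Linear-cong (lin ∘ there) cs≗ds ⟩
    F (d ∷ ds) ∎
    where
    unit : ∀ z → 1# * z + 0# * z ≈ z
    unit z = trans (+-cong (*-identityˡ z) (zeroˡ z)) (+-identityʳ z)

  detᶜ : ∀ n → Vec (Fin n → Carrier) n → Carrier
  detᶜ zero    _  = 1#
  detᶜ (suc n) cs = laplace (λ c → c zero) (detᶜ n ∘ Vec.map (_∘ suc)) cs

  map-Adjacent : ∀ {A B : Set} (f : A → B) {n} {cs : Vec A n} →
                 Adjacent cs → Adjacent (Vec.map f cs)
  map-Adjacent f here        = here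
  map-Adjacent f (there adj) = there (map-Adjacent f adj)

  map-Combination : ∀ {I J : Set} (ι : J → I) {s s′ n} {cs ds es : Vec (I → Carrier) n} →
    Combination s s′ cs ds es →
    Combination s s′ (Vec.map (_∘ ι) cs) (Vec.map (_∘ ι) ds) (Vec.map (_∘ ι) es)
  map-Combination ι (here eq)    = here (eq ∘ ι)
  map-Combination ι (there comb) = there (map-Combination ι comb)

  detᶜ-alternating : ∀ n → Alternating (detᶜ n)
  detᶜ-alternating zero    {[]} ()
  detᶜ-alternating (suc n) =
    laplace-alternating _ (detᶜ-alternating n ∘ map-Adjacent (_∘ suc))

  detᶜ-linear : ∀ n → Linear (detᶜ n)
  detᶜ-linear zero    {cs = []} ()
  detᶜ-linear (suc n) =
    laplace-Linear (λ eq → eq zero) (detᶜ-linear n ∘ map-Combination suc)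

  ∑-cong : ∀ {n} {f g : Fin n → Carrier} → (∀ i → f i ≈ g i) → ∑ f ≈ ∑ g
  ∑-cong {zero}  e = refl
  ∑-cong {suc n} e = +-cong (e zero) (∑-cong (e ∘ suc))

  det≈detᶜ : ∀ {n} (M : Fin n → Fin n → Carrier) →
             det M ≈ detᶜ n (tabulate λ j i → M i j)
  det≈detᶜ {zero}  M = refl
  det≈detᶜ {suc n} M = begin
    det M
      ≈⟨ ∑-cong (λ j → *-congˡ {x = ε ^ toℕ j} (*-congˡ {x = M zero j} (minor j))) ⟩
    ∑ (λ j → ε ^ toℕ j * (M zero j * minorᶜ (tabulate (columns ∘ punchIn j))))
      ≈⟨ laplace-tabulate (λ c → c zero) minorᶜ columns ⟨
    detᶜ (suc n) (tabulate columns) ∎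
    where
    columns : Fin (suc n) → Fin (suc n) → Carrier
    columns j i = M i j

    minorᶜ : Vec (Fin (suc n) → Carrier) n → Carrier
    minorᶜ = detᶜ n ∘ Vec.map (_∘ suc)

    minor : ∀ j → det (λ r c → M (suc r) (punchIn j c)) ≈ minorᶜ (tabulate (columns ∘ punchIn j))
    minor j = trans (det≈detᶜ λ r c → M (suc r) (punchIn j c))
      (reflexive (≡.cong (detᶜ n) (Vec.tabulate-∘ (_∘ suc) (columns ∘ punchIn j))))

  laplace-scale : ∀ {A : Set} {t : A → Carrier} {f : A → A} {s s′ n} {F G : Vec A n → Carrier} →
    (∀ c → t (f c) ≈ s * t c) → (∀ cs → F (Vec.map f cs) ≈ s′ * G cs) →
    ∀ cs → laplace t F (Vec.map f cs) ≈ s * s′ * laplace t G cs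
  laplace-scale {t = t} {f} {s} {s′} {zero} {F} {G} t-scale F-scale (c ∷ []) = begin
    t (f c) * F []         ≈⟨ *-cong (t-scale c) (F-scale []) ⟩
    (s * t c) * (s′ * G [])
      ≈⟨ solve 4 (λ p u q g → (p ⊗ u) ⊗ (q ⊗ g) := p ⊗ q ⊗ (u ⊗ g)) refl s (t c) s′ (G []) ⟩
    s * s′ * (t c * G [])   ∎
  laplace-scale {t = t} {f} {s} {s′} {suc n} {F} {G} t-scale F-scale (c ∷ cs) = begin
    t (f c) * F (Vec.map f cs) + ε * laplace t (F ∘ (f c ∷_)) (Vec.map f cs)
      ≈⟨ +-cong (*-cong (t-scale c) (F-scale cs))
                (*-congˡ (laplace-scale t-scale (F-scale ∘ (c ∷_)) cs)) ⟩
    (s * t c) * (s′ * G cs) + ε * (s * s′ * L)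
      ≈⟨ solve 6 (λ p u q g m l → (p ⊗ u) ⊗ (q ⊗ g) ⊕ m ⊗ (p ⊗ q ⊗ l) :=
                                  p ⊗ q ⊗ (u ⊗ g ⊕ m ⊗ l))
           refl s (t c) s′ (G cs) ε L ⟩
    s * s′ * (t c * G cs + ε * L) ∎
    where L = laplace t (G ∘ (c ∷_)) cs

  -- Row scaling acts on all columns at once, so it does not follow one column at a time from
  -- `Linear`. It serves to move the factors x₁ - xᵢ into the rows of the minor.
  detᶜ-scale : ∀ n (σ : Fin n → Carrier) (cs : Vec (Fin n → Carrier) n) →
    detᶜ n (Vec.map (λ c i → σ i * c i) cs) ≈ ∏ σ * detᶜ n cs
  detᶜ-scale zero    σ cs = sym (*-identityˡ 1#)
  detᶜ-scale (suc n) σ cs = laplace-scale (λ c → refl)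
    (λ ds → trans
      (reflexive (≡.cong (detᶜ n) (≡.trans (≡.sym (Vec.map-∘ (_∘ suc) scale ds))
                                           (Vec.map-∘ scale′ (_∘ suc) ds))))
      (detᶜ-scale n (σ ∘ suc) (Vec.map (_∘ suc) ds)))
    cs
    where
    scale : (Fin (suc n) → Carrier) → Fin (suc n) → Carrier
    scale c i = σ i * c i
    scale′ : (Fin n → Carrier) → Fin n → Carrier
    scale′ c i = σ (suc i) * c i

  -- The quotients of consecutive entries of the first row are given as data, so that this row can
  -- be cleared without dividing.
  data Chain {A : Set} (t : A → Carrier) : ∀ {n} → Vec Carrier n → Vec A (suc n) → Set where
    [_] : ∀ c → Chain t [] (c ∷ [])
    _∷_ : ∀ {n d c c′ ds} {cs : Vec A n} → t c ≈ d * t c′ → Chain t ds (c′ ∷ cs) →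
          Chain t (d ∷ ds) (c ∷ c′ ∷ cs)

  -- Each column is the negative of c - d c′. These n changes of sign absorb the sign of the last
  -- entry in the expansion along the first row.
  differences : ∀ {I : Set} {n} → Vec Carrier n → Vec (I → Carrier) (suc n) → Vec (I → Carrier) n
  differences []       _             = []
  differences (d ∷ ds) (c ∷ c′ ∷ cs) =
    (λ i → d * c′ i + ε * c i) ∷ differences ds (c′ ∷ cs)

  -- Subtracting multiples of the next column from each column clears the
  -- first row except for its last entry.
  laplace-chain : ∀ {I : Set} {t : (I → Carrier) → Carrier} {n}
    {F : Vec (I → Carrier) n → Carrier} → Linear F → Alternating F →
    ∀ {ds cs} → Chain t ds cs → laplace t F cs ≈ t (Vec.last cs) * F (differences ds cs)
  laplace-chain lin alt [ c ] = refl
  laplace-chain {t = t} {suc n} {F} lin alt {d ∷ ds} {c ∷ c′ ∷ cs} (tc≈dtc′ ∷ chain) = begin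
    t c * F (c′ ∷ cs) + ε * laplace t (F ∘ (c ∷_)) (c′ ∷ cs)
      ≈⟨ +-cong (*-congʳ tc≈dtc′) (*-congˡ (laplace-chain (lin ∘ there) (alt ∘ there) chain)) ⟩
    d * t c′ * F (c′ ∷ cs) + ε * (T * F (c ∷ es))
      ≈⟨ +-congʳ (*-assoc _ _ _) ⟩
    d * (t c′ * F (c′ ∷ cs)) + ε * (T * F (c ∷ es))
      -- The product is rewritten as an expansion with a second copy of `c′` kept in front: all its
      -- terms but the first contain `c′` twice. The induction hypothesis then applies to it as
      -- well.
      ≈⟨ +-congʳ (*-congˡ (repeated cs alt)) ⟨
    d * laplace t (F ∘ (c′ ∷_)) (c′ ∷ cs) + ε * (T * F (c ∷ es))
      ≈⟨ +-congʳ (*-congˡ (laplace-chain (lin ∘ there) (alt ∘ there) chain)) ⟩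
    d * (T * F (c′ ∷ es)) + ε * (T * F (c ∷ es))
      ≈⟨ solve 5 (λ u v f m g → u ⊗ (v ⊗ f) ⊕ m ⊗ (v ⊗ g) := v ⊗ (u ⊗ f ⊕ m ⊗ g))
           refl d T (F (c′ ∷ es)) ε (F (c ∷ es)) ⟩
    T * (d * F (c′ ∷ es) + ε * F (c ∷ es))
      ≈⟨ *-congˡ (lin (here λ _ → refl)) ⟨
    T * F ((λ i → d * c′ i + ε * c i) ∷ es) ∎
    where
    T  = t (Vec.last (c′ ∷ cs))
    es = differences ds (c′ ∷ cs)

    repeated : ∀ {m c} {F : Vec _ (suc m) → Carrier} (cs : Vec _ m) → Alternating F →
               laplace t (F ∘ (c ∷_)) (c ∷ cs) ≈ t c * F (c ∷ cs)
    repeated []       alt = refl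
    repeated {c = c} {F} cs@(_ ∷ _) alt = trans
      (+-congˡ (trans (*-congˡ (laplace-zero t (λ _ → alt here) cs)) (zeroʳ ε))) (+-identityʳ _)

-- Interlacing diagrams and factorial powers

first : ∀ {n} → Vec ℕ n → ℕ
first []      = 0
first (r ∷ _) = r

data Decreasing : ∀ {n} → Vec ℕ n → Set where
  []  : Decreasing []
  _∷_ : ∀ {n r} {rs : Vec ℕ n} → first rs ≤ r → Decreasing rs → Decreasing (r ∷ rs)

-- Both diagrams have the same number of rows; through `first [] = 0` the last row of the second one
-- ranges from 0 up to the last row of the first.
data Interlacing : ∀ {n} → Vec ℕ n → Vec ℕ n → Set where
  []  : Interlacing [] []
  _∷_ : ∀ {n r k} {rs ks : Vec ℕ n} → first rs ≤ k × k ≤ r → Interlacing rs ks →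
        Interlacing (r ∷ rs) (k ∷ ks)

module RangeSums (R : CommutativeRing 0ℓ 0ℓ) where

  open CommutativeRing R hiding (zero)
  open SetoidReasoning setoid

  -- Both ends are included: f l + f (l + 1) + ⋯ + f (l + e).
  ∑range : ℕ → ℕ → (ℕ → Carrier) → Carrier
  ∑range l zero    f = f l
  ∑range l (suc e) f = f l + ∑range (suc l) e f

  ∑range-cong : ∀ l e {f g} → (∀ k → l ≤ k → k ≤ l ℕ.+ e → f k ≈ g k) →
                ∑range l e f ≈ ∑range l e g
  ∑range-cong l zero    f≈g = f≈g l ℕ.≤-refl (ℕ.m≤m+n l 0)
  ∑range-cong l (suc e) f≈g = +-cong (f≈g l ℕ.≤-refl (ℕ.m≤m+n l _))
    (∑range-cong (suc l) e λ k l<k k≤ →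
      f≈g k (ℕ.<⇒≤ l<k) (ℕ.≤-trans k≤ (ℕ.≤-reflexive (≡.sym (ℕ.+-suc l e)))))

  ∑range-*ˡ : ∀ z l e f → ∑range l e (λ k → z * f k) ≈ z * ∑range l e f
  ∑range-*ˡ z l zero    f = refl
  ∑range-*ˡ z l (suc e) f = trans (+-congˡ (∑range-*ˡ z (suc l) e f)) (sym (distribˡ z _ _))

  ∑range-drop : ∀ l d e {f} → (∀ k → k < l ℕ.+ d → f k ≈ 0#) →
                ∑range l (d ℕ.+ e) f ≈ ∑range (l ℕ.+ d) e f
  ∑range-drop l zero    e f≈0 = reflexive (≡.cong (λ k → ∑range k e _) (≡.sym (ℕ.+-identityʳ l)))
  ∑range-drop l (suc d) e {f} f≈0 = begin
    f l + ∑range (suc l) (d ℕ.+ e) f ≈⟨ +-cong (f≈0 l (ℕ.m<m+n l ℕ.z<s))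
      (∑range-drop (suc l) d e λ k k< → f≈0 k (≡.subst (k <_) (≡.sym (ℕ.+-suc l d)) k<)) ⟩
    0# + ∑range (suc (l ℕ.+ d)) e f ≈⟨ +-identityˡ _ ⟩
    ∑range (suc (l ℕ.+ d)) e f      ≡⟨ ≡.cong (λ k → ∑range k e f) (ℕ.+-suc l d) ⟨
    ∑range (l ℕ.+ suc d) e f        ∎

  -- The sum over the diagrams interlacing with ν that have one row less.
  ∑lace : ∀ {n} → Vec ℕ (suc n) → (Vec ℕ n → Carrier) → Carrier
  ∑lace (r ∷ [])          G = G []
  ∑lace (r ∷ ν@(r′ ∷ _)) G = ∑range r′ (r ∸ r′) λ k → ∑lace ν (G ∘ (k ∷_))

  ∑lace-*ˡ : ∀ {n} z (ν : Vec ℕ (suc n)) G → ∑lace ν (λ μ → z * G μ) ≈ z * ∑lace ν G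
  ∑lace-*ˡ z (r ∷ [])         G = refl
  ∑lace-*ˡ z (r ∷ ν@(r′ ∷ _)) G = trans
    (∑range-cong r′ (r ∸ r′) λ k _ _ → ∑lace-*ˡ z ν (G ∘ (k ∷_)))
    (∑range-*ˡ z r′ (r ∸ r′) _)

  ∑lace-cong : ∀ {n} (ν : Vec ℕ (suc n)) → Decreasing ν → ∀ {G H} →
    (∀ μ → Interlacing ν (μ Vec.∷ʳ 0) → G μ ≈ H μ) → ∑lace ν G ≈ ∑lace ν H
  ∑lace-cong (r ∷ [])         _           e = e [] ((z≤n , z≤n) ∷ [])
  ∑lace-cong (r ∷ ν@(r′ ∷ _)) (r′≤r ∷ d) e = ∑range-cong r′ (r ∸ r′) λ k r′≤k k≤ →
    ∑lace-cong ν d λ μ lace →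
      e (k ∷ μ) ((r′≤k , ≡.subst (k ≤_) (ℕ.m+[n∸m]≡n r′≤r) k≤) ∷ lace)

-- Factorial powers and the branching rule for their determinants

module FactorialPowers (R : CommutativeRing 0ℓ 0ℓ) (β : ℕ → CommutativeRing.Carrier R) where

  open CommutativeRing R hiding (zero)
  open RingOps R
  open Determinants R
  open RangeSums R
  open SetoidReasoning setoid
  open SemiringSolver commutativeSemiring
    using (solve; _:=_) renaming (_:+_ to _⊕_; _:*_ to _⊗_)

  -- For βₖ = aₙ₋ₖ and `l` = 0 this is the power (z‖a)^q. Other starting points occur because a
  -- horizontal strip of boxes contributes a segment of such a product.
  factorial : Carrier → ℕ → ℕ → Carrier
  factorial z l zero    = 1#
  factorial z l (suc q) = (z - β l) * factorial z (suc l) q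

  factorial-+ : ∀ z l p q → factorial z l (p ℕ.+ q) ≈ factorial z l p * factorial z (l ℕ.+ p) q
  factorial-+ z l zero    q = sym (trans (*-identityˡ _)
    (reflexive (≡.cong (λ k → factorial z k q) (ℕ.+-identityʳ l))))
  factorial-+ z l (suc p) q = begin
    (z - β l) * factorial z (suc l) (p ℕ.+ q)
      ≈⟨ *-congˡ (factorial-+ z (suc l) p q) ⟩
    (z - β l) * (factorial z (suc l) p * factorial z (suc l ℕ.+ p) q)
      ≈⟨ *-assoc _ _ _ ⟨
    factorial z l (suc p) * factorial z (suc l ℕ.+ p) q
      ≡⟨ ≡.cong (λ k → factorial z l (suc p) * factorial z k q) (ℕ.+-suc l p) ⟨
    factorial z l (suc p) * factorial z (l ℕ.+ suc p) q ∎

  factorial-suc : ∀ z q → factorial z 0 (suc q) ≈ factorial z 0 q * (z - β q)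
  factorial-suc z q = begin
    factorial z 0 (suc q)                ≡⟨ ≡.cong (factorial z 0) (ℕ.+-comm 1 q) ⟩
    factorial z 0 (q ℕ.+ 1)              ≈⟨ factorial-+ z 0 q 1 ⟩
    factorial z 0 q * ((z - β q) * 1#)   ≈⟨ *-congˡ (*-identityʳ _) ⟩
    factorial z 0 q * (z - β q)          ∎

  difference-shift : ∀ z₁ z₂ b → z₁ - z₂ ≈ (z₁ - b) + ε * (z₂ - b)
  difference-shift z₁ z₂ b = begin
    z₁ - z₂                            ≈⟨ +-congˡ (RingProperties.-1*x≈-x ring z₂) ⟨
    z₁ + ε * z₂                        ≈⟨ +-identityʳ _ ⟨
    z₁ + ε * z₂ + 0#                   ≈⟨ +-congˡ (z+εz≈0 (- b)) ⟨
    z₁ + ε * z₂ + (- b + ε * - b)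
      ≈⟨ solve 4 (λ u v m b → u ⊕ m ⊗ v ⊕ (b ⊕ m ⊗ b) := (u ⊕ b) ⊕ m ⊗ (v ⊕ b)) refl z₁ z₂ ε (- b) ⟩
    (z₁ - b) + ε * (z₂ - b)            ∎

  -- Writing z₁ - z₂ = (z₁ - βₘ₊ₖ) - (z₂ - βₘ₊ₖ) in the k-th summand makes the sum telescope.
  telescope : ∀ z₁ z₂ m l e →
    (z₁ - z₂) * ∑range l e (λ k → factorial z₁ (suc m ℕ.+ k) ((l ℕ.+ e) ∸ k) * factorial z₂ 0 (m ℕ.+ k))
    ≈ factorial z₁ (m ℕ.+ l) (suc e) * factorial z₂ 0 (m ℕ.+ l)
      + ε * factorial z₂ 0 (m ℕ.+ l ℕ.+ suc e)
  telescope z₁ z₂ m l zero = begin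
    (z₁ - z₂) * (factorial z₁ (suc m ℕ.+ l) ((l ℕ.+ 0) ∸ l) * B)
      ≡⟨ ≡.cong (λ k → (z₁ - z₂) * (factorial z₁ (suc m ℕ.+ l) k * B)) (ℕ.m+n∸m≡n l 0) ⟩
    (z₁ - z₂) * (1# * B)
      ≈⟨ *-congʳ (difference-shift z₁ z₂ (β (m ℕ.+ l))) ⟩
    (U + ε * V) * (1# * B)
      ≈⟨ solve 5 (λ u m v i b → (u ⊕ m ⊗ v) ⊗ (i ⊗ b) := u ⊗ i ⊗ b ⊕ m ⊗ (i ⊗ b ⊗ v)) refl U ε V 1# B ⟩
    U * 1# * B + ε * (1# * B * V)
      ≈⟨ +-congˡ (*-congˡ (*-congʳ (*-identityˡ B))) ⟩
    U * 1# * B + ε * (B * V)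
      ≈⟨ +-congˡ (*-congˡ (factorial-suc z₂ (m ℕ.+ l))) ⟨
    U * 1# * B + ε * factorial z₂ 0 (suc (m ℕ.+ l))
      ≡⟨ ≡.cong (λ k → U * 1# * B + ε * factorial z₂ 0 k) (ℕ.+-comm 1 (m ℕ.+ l)) ⟩
    U * 1# * B + ε * factorial z₂ 0 (m ℕ.+ l ℕ.+ 1) ∎
    where
    U = z₁ - β (m ℕ.+ l)
    V = z₂ - β (m ℕ.+ l)
    B = factorial z₂ 0 (m ℕ.+ l)
  telescope z₁ z₂ m l (suc e)
    rewrite ℕ.m+n∸m≡n l (suc e) | ℕ.+-suc l e = begin
    (z₁ - z₂) * (A * B + S)
      ≈⟨ distribˡ _ _ _ ⟩
    (z₁ - z₂) * (A * B) + (z₁ - z₂) * S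
      ≈⟨ +-cong (*-congʳ (difference-shift z₁ z₂ (β (m ℕ.+ l)))) (telescope z₁ z₂ m (suc l) e) ⟩
    (U + ε * V) * (A * B) + (factorial z₁ (m ℕ.+ suc l) (suc e) * factorial z₂ 0 (m ℕ.+ suc l)
      + ε * factorial z₂ 0 (m ℕ.+ suc l ℕ.+ suc e))
      ≡⟨ ≡.cong (λ k → (U + ε * V) * (A * B) + (factorial z₁ k (suc e) * factorial z₂ 0 k
            + ε * factorial z₂ 0 (k ℕ.+ suc e))) (ℕ.+-suc m l) ⟩
    (U + ε * V) * (A * B) + (A * factorial z₂ 0 (suc (m ℕ.+ l)) + ε * factorial z₂ 0 (suc (m ℕ.+ l) ℕ.+ suc e))
      ≈⟨ +-congˡ (+-congʳ (*-congˡ (factorial-suc z₂ (m ℕ.+ l)))) ⟩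
    (U + ε * V) * (A * B) + (A * (B * V) + ε * factorial z₂ 0 (suc (m ℕ.+ l) ℕ.+ suc e))
      ≈⟨ solve 6 (λ u m v a b c → (u ⊕ m ⊗ v) ⊗ (a ⊗ b) ⊕ (a ⊗ (b ⊗ v) ⊕ c) :=
                    u ⊗ a ⊗ b ⊕ c ⊕ (v ⊗ (a ⊗ b) ⊕ m ⊗ (v ⊗ (a ⊗ b))))
           refl U ε V A B _ ⟩
    U * A * B + ε * factorial z₂ 0 (suc (m ℕ.+ l) ℕ.+ suc e) + (V * (A * B) + ε * (V * (A * B)))
      ≈⟨ trans (+-congˡ (z+εz≈0 _)) (+-identityʳ _) ⟩
    U * A * B + ε * factorial z₂ 0 (suc (m ℕ.+ l) ℕ.+ suc e)
      ≡⟨ ≡.cong (λ k → U * A * B + ε * factorial z₂ 0 k) (ℕ.+-suc (m ℕ.+ l) (suc e)) ⟨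
    U * A * B + ε * factorial z₂ 0 (m ℕ.+ l ℕ.+ suc (suc e)) ∎
    where
    U = z₁ - β (m ℕ.+ l)
    V = z₂ - β (m ℕ.+ l)
    A = factorial z₁ (suc (m ℕ.+ l)) (suc e)
    B = factorial z₂ 0 (m ℕ.+ l)
    S = ∑range (suc l) e λ k →
      factorial z₁ (suc m ℕ.+ k) (suc (l ℕ.+ e) ∸ k) * factorial z₂ 0 (m ℕ.+ k)

  module _ (z : Carrier) where

    -- The weight of the boxes holding the smallest entry. A box in column `c` with `d` rows below
    -- its own contributes z - β (d + c); the bottom row consists of such boxes only.
    laceWeight : ∀ {n} → Vec ℕ (suc n) → Vec ℕ n → Carrier
    laceWeight (r ∷ [])                  []      = factorial z 0 r
    laceWeight {suc n} (r ∷ ν@(_ ∷ _)) (k ∷ μ) =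
      factorial z (suc n ℕ.+ k) (r ∸ k) * laceWeight ν μ

    -- In the first row of the matrix the exponents suc n + r and n + r′ are neighbours; the
    -- quotient of the two powers is the segment between them.
    ratios : ∀ {n} → Vec ℕ (suc n) → Vec Carrier n
    ratios (r ∷ [])                  = []
    ratios {suc n} (r ∷ ν@(r′ ∷ _)) = factorial z (n ℕ.+ r′) (suc (r ∸ r′)) ∷ ratios ν

  module _ {I : Set} (X : I → Carrier) where

    columns : ∀ {n} → Vec ℕ n → Vec (I → Carrier) n
    columns []               = []
    columns {suc n} (r ∷ ν) = (λ i → factorial (X i) 0 (n ℕ.+ r)) ∷ columns ν

    module _ (z : Carrier) where

      -- The cleared columns with the row factors z - X i taken out; `telescope` is the reason these
      -- factors are there.
      laceColumns : ∀ {n} → Vec ℕ (suc n) → Vec (I → Carrier) n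
      laceColumns (r ∷ [])                  = []
      laceColumns {suc n} (r ∷ ν@(r′ ∷ _)) =
        (λ i → ∑range r′ (r ∸ r′) λ k →
          factorial z (suc n ℕ.+ k) (r ∸ k) * factorial (X i) 0 (n ℕ.+ k))
        ∷ laceColumns ν

      Linear-∑range : ∀ {n} {F : Vec (I → Carrier) (suc n) → Carrier} → Linear F →
        ∀ l e (v : ℕ → Carrier) (C : ℕ → I → Carrier) cs →
        F ((λ i → ∑range l e λ k → v k * C k i) ∷ cs) ≈ ∑range l e (λ k → v k * F (C k ∷ cs))
      Linear-∑range {F = F} lin l zero v C cs = begin
        F ((λ i → v l * C l i) ∷ cs)
          ≈⟨ lin (here λ i → trans (sym (+-identityʳ _)) (+-congˡ (sym (zeroˡ (C l i))))) ⟩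
        v l * F (C l ∷ cs) + 0# * F (C l ∷ cs) ≈⟨ trans (+-congˡ (zeroˡ _)) (+-identityʳ _) ⟩
        v l * F (C l ∷ cs)                     ∎
      Linear-∑range {F = F} lin l (suc e) v C cs = begin
        F ((λ i → v l * C l i + ∑range (suc l) e (λ k → v k * C k i)) ∷ cs)
          ≈⟨ lin (here λ i → +-congˡ (sym (*-identityˡ _))) ⟩
        v l * F (C l ∷ cs) + 1# * F ((λ i → ∑range (suc l) e (λ k → v k * C k i)) ∷ cs)
          ≈⟨ +-congˡ (trans (*-identityˡ _) (Linear-∑range lin (suc l) e v C cs)) ⟩
        v l * F (C l ∷ cs) + ∑range (suc l) e (λ k → v k * F (C k ∷ cs)) ∎

      -- For fixed `ν` the rows of `μ` vary independently of each other, and the weight is a product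
      -- over rows. Multilinearity therefore absorbs the sum over each row into the column of that
      -- row; the bottom row of `ν` leaves the common factor.
      ∑lace-linear : ∀ {n} {F : Vec (I → Carrier) n → Carrier} → Linear F →
        (ν : Vec ℕ (suc n)) →
        ∑lace ν (λ μ → laceWeight z ν μ * F (columns μ)) ≈
        factorial z 0 (Vec.last ν) * F (laceColumns ν)
      ∑lace-linear lin (r ∷ []) = refl
      ∑lace-linear {suc n} {F} lin (r ∷ ν@(r′ ∷ _)) = begin
        ∑range r′ (r ∸ r′) (λ k → ∑lace ν λ μ → v k * laceWeight z ν μ * F (C k ∷ columns μ))
          ≈⟨ ∑range-cong r′ (r ∸ r′) (λ k _ _ → term k) ⟩
        ∑range r′ (r ∸ r′) (λ k → T * (v k * F (C k ∷ cs)))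
          ≈⟨ ∑range-*ˡ T r′ (r ∸ r′) _ ⟩
        T * ∑range r′ (r ∸ r′) (λ k → v k * F (C k ∷ cs))
          ≈⟨ *-congˡ (Linear-∑range lin r′ (r ∸ r′) v C cs) ⟨
        T * F (laceColumns (r ∷ ν)) ∎
        where
        T = factorial z 0 (Vec.last ν)
        cs = laceColumns ν
        v = λ k → factorial z (suc n ℕ.+ k) (r ∸ k)
        C = λ k i → factorial (X i) 0 (n ℕ.+ k)

        term : ∀ k → ∑lace ν (λ μ → v k * laceWeight z ν μ * F (C k ∷ columns μ)) ≈
                     T * (v k * F (C k ∷ cs))
        term k = begin
          ∑lace ν (λ μ → v k * laceWeight z ν μ * F (C k ∷ columns μ))
            ≈⟨ lace-assoc ν ⟩
          v k * ∑lace ν (λ μ → laceWeight z ν μ * F (C k ∷ columns μ))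
            ≈⟨ *-congˡ (∑lace-linear (lin ∘ there) ν) ⟩
          v k * (T * F (C k ∷ cs))
            ≈⟨ solve 3 (λ p q f → p ⊗ (q ⊗ f) := q ⊗ (p ⊗ f)) refl (v k) T _ ⟩
          T * (v k * F (C k ∷ cs)) ∎
          where
          lace-assoc : ∀ {m} (ν : Vec ℕ (suc m)) {s} {G H : Vec ℕ m → Carrier} →
            ∑lace ν (λ μ → s * G μ * H μ) ≈ s * ∑lace ν (λ μ → G μ * H μ)
          lace-assoc (r ∷ [])         = *-assoc _ _ _
          lace-assoc (r ∷ ν@(r′ ∷ _)) {s} = trans
            (∑range-cong r′ (r ∸ r′) λ k _ _ → lace-assoc ν)
            (∑range-*ˡ s r′ (r ∸ r′) _)

  private
    exponent : ∀ m {r r′} → r′ ≤ r → suc m ℕ.+ r ≡ m ℕ.+ r′ ℕ.+ suc (r ∸ r′)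
    exponent m {r} {r′} r′≤r = ≡.trans
      (≡.cong (λ k → suc (m ℕ.+ k)) (≡.sym (ℕ.m+[n∸m]≡n r′≤r)))
      (≡.trans (≡.cong suc (≡.sym (ℕ.+-assoc m r′ _))) (≡.sym (ℕ.+-suc (m ℕ.+ r′) _)))

  module _ {n : ℕ} (X : Fin (suc n) → Carrier) where

    private
      z = X zero

      σ : Fin n → Carrier
      σ i = z - X (suc i)

    columns-Chain : ∀ {m} {ν : Vec ℕ (suc m)} → Decreasing ν →
                    Chain (λ c → c zero) (ratios z ν) (columns X ν)
    columns-Chain {ν = r ∷ []}                 _          = [ _ ]
    columns-Chain {suc m} {ν = r ∷ ν@(r′ ∷ _)} (r′≤r ∷ d) = (begin
      factorial z 0 (suc m ℕ.+ r)
        ≡⟨ ≡.cong (factorial z 0) (exponent m r′≤r) ⟩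
      factorial z 0 (m ℕ.+ r′ ℕ.+ suc (r ∸ r′))
        ≈⟨ factorial-+ z 0 (m ℕ.+ r′) (suc (r ∸ r′)) ⟩
      factorial z 0 (m ℕ.+ r′) * factorial z (m ℕ.+ r′) (suc (r ∸ r′))
        ≈⟨ *-comm _ _ ⟩
      factorial z (m ℕ.+ r′) (suc (r ∸ r′)) * factorial z 0 (m ℕ.+ r′) ∎) ∷ columns-Chain d

    columns-last : ∀ {m} (ν : Vec ℕ (suc m)) →
                   Vec.last (columns X ν) zero ≡ factorial z 0 (Vec.last ν)
    columns-last (r ∷ [])         = ≡.refl
    columns-last (r ∷ ν@(_ ∷ _)) = columns-last ν

    scale-laceColumns : ∀ {m} {ν : Vec ℕ (suc m)} → Decreasing ν →
      Pointwise _≗_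
        (Vec.map (λ c i → σ i * c i) (laceColumns (X ∘ suc) z ν))
        (Vec.map (_∘ suc) (differences (ratios z ν) (columns X ν)))
    scale-laceColumns {ν = r ∷ []}                 _          = []
    scale-laceColumns {suc m} {ν = r ∷ ν@(r′ ∷ _)} (r′≤r ∷ d) = head ∷ scale-laceColumns d
      where
      head : ∀ i → σ i * ∑range r′ (r ∸ r′) (λ k →
                     factorial z (suc m ℕ.+ k) (r ∸ k) * factorial (X (suc i)) 0 (m ℕ.+ k))
        ≈ factorial z (m ℕ.+ r′) (suc (r ∸ r′)) * factorial (X (suc i)) 0 (m ℕ.+ r′)
          + ε * factorial (X (suc i)) 0 (suc m ℕ.+ r)
      head i = begin
        σ i * ∑range r′ (r ∸ r′) (λ k →
          factorial z (suc m ℕ.+ k) (r ∸ k) * factorial (X (suc i)) 0 (m ℕ.+ k))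
          ≡⟨ ≡.cong (λ s → σ i * ∑range r′ (r ∸ r′) (λ k →
               factorial z (suc m ℕ.+ k) (s ∸ k) * factorial (X (suc i)) 0 (m ℕ.+ k)))
               (≡.sym (ℕ.m+[n∸m]≡n r′≤r)) ⟩
        _ ≈⟨ telescope z (X (suc i)) m r′ (r ∸ r′) ⟩
        _ ≡⟨ ≡.cong (λ s → factorial z (m ℕ.+ r′) (suc (r ∸ r′)) * factorial (X (suc i)) 0 (m ℕ.+ r′)
               + ε * factorial (X (suc i)) 0 s) (≡.sym (exponent m r′≤r)) ⟩
        _ ∎

    -- The counterpart of `tableauSum-branching`. The factor `T` plays two parts: it is the entry of
    -- the first row that is not cleared, and the weight of the bottom row of `ν`.
    detᶜ-columns-branching : (ν : Vec ℕ (suc n)) → Decreasing ν →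
      ∏ σ * ∑lace ν (λ μ → laceWeight z ν μ * detᶜ n (columns (X ∘ suc) μ)) ≈
      detᶜ (suc n) (columns X ν)
    detᶜ-columns-branching ν d = begin
      ∏ σ * ∑lace ν (λ μ → laceWeight z ν μ * detᶜ n (columns (X ∘ suc) μ))
        ≈⟨ *-congˡ (∑lace-linear (X ∘ suc) z (detᶜ-linear n) ν) ⟩
      ∏ σ * (T * detᶜ n (laceColumns (X ∘ suc) z ν))
        ≈⟨ solve 3 (λ p q f → p ⊗ (q ⊗ f) := q ⊗ (p ⊗ f)) refl (∏ σ) T _ ⟩
      T * (∏ σ * detᶜ n (laceColumns (X ∘ suc) z ν))
        ≈⟨ *-congˡ (detᶜ-scale n σ _) ⟨
      T * detᶜ n (Vec.map (λ c i → σ i * c i) (laceColumns (X ∘ suc) z ν))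
        ≈⟨ *-congˡ (Linear-cong (detᶜ-linear n) (scale-laceColumns d)) ⟩
      T * detᶜ n (Vec.map (_∘ suc) (differences (ratios z ν) (columns X ν)))
        ≈⟨ *-congʳ (reflexive (columns-last ν)) ⟨
      Vec.last (columns X ν) zero *
        detᶜ n (Vec.map (_∘ suc) (differences (ratios z ν) (columns X ν)))
        ≈⟨ laplace-chain (detᶜ-linear n ∘ map-Combination suc)
             (detᶜ-alternating n ∘ map-Adjacent (_∘ suc)) (columns-Chain d) ⟨
      detᶜ (suc n) (columns X ν) ∎
      where T = factorial z 0 (Vec.last ν)

-- Reverse tableaux

cells : ℕ → ℕ → ℕ → Diagram
cells i c zero    = []
cells i c (suc m) = (i , c) ∷ cells i (suc c) m

diagram : ∀ {n} → ℕ → Vec ℕ n → Diagram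
diagram i []      = []
diagram i (r ∷ ν) = cells i 0 r ++ diagram (suc i) ν

outside : ∀ {n} → ℕ → Vec ℕ n → Vec ℕ n → Diagram
outside i []      []      = []
outside i (r ∷ ν) (k ∷ μ) = cells i k (r ∸ k) ++ outside (suc i) ν μ

partᵛ : ∀ {n} → Vec ℕ n → ℕ → ℕ
partᵛ = part ∘ toList

first≡partᵛ-0 : ∀ {n} (ν : Vec ℕ n) → first ν ≡ partᵛ ν 0
first≡partᵛ-0 []      = ≡.refl
first≡partᵛ-0 (r ∷ ν) = ≡.refl

∈-cells⁺ : ∀ i {c l} m → l ≤ c → c < l ℕ.+ m → (i , c) ∈ cells i l m
∈-cells⁺ i {c} {l} zero    l≤c c<l+m =
  ⊥-elim (ℕ.<⇒≱ c<l+m (ℕ.≤-trans (ℕ.≤-reflexive (ℕ.+-identityʳ l)) l≤c))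
∈-cells⁺ i {c} {l} (suc m) l≤c c<l+m with l ℕ.≟ c
... | yes ≡.refl = here ≡.refl
... | no  l≢c    = there (∈-cells⁺ i m (ℕ.≤∧≢⇒< l≤c l≢c) (≡.subst (c <_) (ℕ.+-suc l m) c<l+m))

∈-cells⁻ : ∀ {i l j c} m → (j , c) ∈ cells i l m → j ≡ i × l ≤ c × c < l ℕ.+ m
∈-cells⁻ {l = l} (suc m) (here ≡.refl) = ≡.refl , ℕ.≤-refl , ℕ.m<m+n l ℕ.z<s
∈-cells⁻ {l = l} {c = c} (suc m) (there j,c∈) with ∈-cells⁻ m j,c∈
... | j≡i , l<c , c< = j≡i , ℕ.<⇒≤ l<c , ≡.subst (c <_) (≡.sym (ℕ.+-suc l m)) c<

∈-diagram⁺ : ∀ {n} i (ν : Vec ℕ n) d {c} → c < partᵛ ν d → (i ℕ.+ d , c) ∈ diagram i ν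
∈-diagram⁺ i (r ∷ ν) zero    c<r rewrite ℕ.+-identityʳ i = ∈-++⁺ˡ (∈-cells⁺ i r z≤n c<r)
∈-diagram⁺ i (r ∷ ν) (suc d) c<  rewrite ℕ.+-suc i d =
  ∈-++⁺ʳ (cells i 0 r) (∈-diagram⁺ (suc i) ν d c<)

∈-diagram⁻ : ∀ {n i j c} (ν : Vec ℕ n) → (j , c) ∈ diagram i ν →
             ∃[ d ] j ≡ i ℕ.+ d × c < partᵛ ν d
∈-diagram⁻ {i = i} (r ∷ ν) j,c∈ with ∈-++⁻ (cells i 0 r) j,c∈
... | inj₁ j,c∈cells with ∈-cells⁻ r j,c∈cells
...   | j≡i , _ , c<r = 0 , ≡.trans j≡i (≡.sym (ℕ.+-identityʳ i)) , c<r
∈-diagram⁻ {i = i} (r ∷ ν) j,c∈ | inj₂ j,c∈ν with ∈-diagram⁻ ν j,c∈ν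
...   | d , j≡ , c< = suc d , ≡.trans j≡ (≡.sym (ℕ.+-suc i d)) , c<

∈-outside⁻ : ∀ {n i j c} {ν μ : Vec ℕ n} → Interlacing ν μ → (j , c) ∈ outside i ν μ →
             ∃[ d ] j ≡ i ℕ.+ d × partᵛ μ d ≤ c × c < partᵛ ν d
∈-outside⁻ {i = i} {c = c} {ν = r ∷ ν} {k ∷ μ} ((_ , k≤r) ∷ lace) j,c∈
  with ∈-++⁻ (cells i k (r ∸ k)) j,c∈
... | inj₁ j,c∈cells with ∈-cells⁻ (r ∸ k) j,c∈cells
...   | j≡i , k≤c , c< =
        0 , ≡.trans j≡i (≡.sym (ℕ.+-identityʳ i)) , k≤c , ≡.subst (c <_) (ℕ.m+[n∸m]≡n k≤r) c<
∈-outside⁻ {i = i} {ν = r ∷ ν} {k ∷ μ} (_ ∷ lace) j,c∈ | inj₂ j,c∈ν with ∈-outside⁻ lace j,c∈ν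
...   | d , j≡ , bounds = suc d , ≡.trans j≡ (≡.sym (ℕ.+-suc i d)) , bounds

Interlacing-upper : ∀ {n} {ν μ : Vec ℕ n} → Interlacing ν μ → ∀ d → partᵛ μ d ≤ partᵛ ν d
Interlacing-upper []                 d       = z≤n
Interlacing-upper ((_ , k≤r) ∷ lace) zero    = k≤r
Interlacing-upper (_ ∷ lace)         (suc d) = Interlacing-upper lace d

Interlacing-lower : ∀ {n} {ν μ : Vec ℕ n} → Interlacing ν μ → ∀ d → partᵛ ν (suc d) ≤ partᵛ μ d
Interlacing-lower []                 d       = z≤n
Interlacing-lower {ν = r ∷ ν} ((ν≤k , _) ∷ lace) zero =
  ≡.subst (_≤ _) (first≡partᵛ-0 ν) ν≤k
Interlacing-lower (_ ∷ lace)         (suc d) = Interlacing-lower lace d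

Interlacing-< : ∀ {n} {ν μ : Vec ℕ n} → Interlacing ν μ → ∀ {d d′} → d < d′ →
                partᵛ ν d′ ≤ partᵛ μ d
Interlacing-< lace {d} {suc d′} (s≤s d≤d′) with ℕ.m≤n⇒m<n∨m≡n d≤d′
... | inj₂ ≡.refl = Interlacing-lower lace d
... | inj₁ d<d′   = ℕ.≤-trans (Interlacing-lower lace d′)
                      (ℕ.≤-trans (Interlacing-upper lace d′) (Interlacing-< lace d<d′))

Interlacing⇒Decreasing : ∀ {n} {ν μ : Vec ℕ n} → Interlacing ν μ → Decreasing μ
Interlacing⇒Decreasing []         = []
Interlacing⇒Decreasing {μ = k ∷ μ} lace@(_ ∷ lace′) =
  ≡.subst (_≤ k) (≡.sym (first≡partᵛ-0 μ))
    (ℕ.≤-trans (Interlacing-upper lace′ 0) (Interlacing-< lace {0} {1} ℕ.z<s))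
  ∷ Interlacing⇒Decreasing lace′

last≤partᵛ : ∀ {n} {ν : Vec ℕ (suc n)} → Decreasing ν → ∀ d → d ≤ n → Vec.last ν ≤ partᵛ ν d
last≤partᵛ {ν = r ∷ []}       _         zero    _         = ℕ.≤-refl
last≤partᵛ {ν = r ∷ r′ ∷ ν} (r′≤r ∷ D) zero    _         = ℕ.≤-trans (last≤partᵛ D 0 z≤n) r′≤r
last≤partᵛ {ν = r ∷ r′ ∷ ν} (_ ∷ D)    (suc d) (s≤s d≤n) = last≤partᵛ D d d≤n

-- In a reverse tableau whose smallest entry fills the boxes of u and whose
-- other entries fill those of v, neither of the following happens.
data Clash (u v : Diagram) : Set where
  row-clash : ∀ {i c c′} → (i , c) ∈ u → (i , c′) ∈ v → c < c′ → Clash u v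
  col-clash : ∀ {i i′ c} → (i , c) ∈ u → (i′ , c) ∈ u ⊎ (i′ , c) ∈ v → i < i′ → Clash u v

Clash-++ : ∀ p q {u v} → Clash u v → Clash (p ++ u) (q ++ v)
Clash-++ p q (row-clash α∈u β∈v c<c′)        = row-clash (∈-++⁺ʳ p α∈u) (∈-++⁺ʳ q β∈v) c<c′
Clash-++ p q (col-clash α∈u (inj₁ β∈u) i<i′) =
  col-clash (∈-++⁺ʳ p α∈u) (inj₁ (∈-++⁺ʳ p β∈u)) i<i′
Clash-++ p q (col-clash α∈u (inj₂ β∈v) i<i′) =
  col-clash (∈-++⁺ʳ p α∈u) (inj₂ (∈-++⁺ʳ q β∈v)) i<i′

-- A box outside `μ` in row d lies in a column c ≥ μ_d. Boxes of `μ` in this row are further left,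
-- and so are all boxes of `ν` in lower rows d′, since ν_d′ ≤ μ_d.
Interlacing⇒¬Clash : ∀ {n} {ν μ : Vec ℕ n} → Interlacing ν μ →
                     ¬ Clash (outside 0 ν μ) (diagram 0 μ)
Interlacing⇒¬Clash {μ = μ} lace (row-clash α∈u β∈v c<c′)
  with ∈-outside⁻ lace α∈u | ∈-diagram⁻ μ β∈v
... | d , ≡.refl , μ≤c , _ | d , ≡.refl , c′<μ = ℕ.<⇒≱ (ℕ.<-trans c<c′ c′<μ) μ≤c
Interlacing⇒¬Clash lace (col-clash α∈u (inj₁ β∈u) i<i′)
  with ∈-outside⁻ lace α∈u | ∈-outside⁻ lace β∈u
... | d , ≡.refl , μ≤c , _ | d′ , ≡.refl , _ , c<ν =
  ℕ.<⇒≱ c<ν (ℕ.≤-trans (Interlacing-< lace i<i′) μ≤c)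
Interlacing⇒¬Clash {μ = μ} lace (col-clash α∈u (inj₂ β∈v) i<i′)
  with ∈-outside⁻ lace α∈u | ∈-diagram⁻ μ β∈v
... | d , ≡.refl , μ≤c , _ | d′ , ≡.refl , c<μ =
  ℕ.<⇒≱ (ℕ.<-≤-trans c<μ (Interlacing-upper lace d′))
    (ℕ.≤-trans (Interlacing-< lace i<i′) μ≤c)

-- Reverse tableaux as lists, and removal of the smallest entry

module _ {n : ℕ} where

  IsReverseTableau : Filling n → Set
  IsReverseTableau = IsTableau Fin._≥_ Fin._>_

  isReverseTableau? : ∀ T → Dec (IsReverseTableau T)
  isReverseTableau? = isTableau? Fin._≥_ Fin._>_ (flip Fin._≤?_) (flip Fin._<?_)

  boxes : Filling n → Diagram
  boxes = List.map proj₁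

  compatible : ∀ {T : Filling n} → IsReverseTableau T → ∀ {p q} → p ∈ T → q ∈ T →
               Compatible Fin._≥_ Fin._>_ p q
  compatible tab p∈T = All.lookup (All.lookup tab p∈T)

  fromCompatible : ∀ {T : Filling n} →
                   (∀ {p q} → p ∈ T → q ∈ T → Compatible Fin._≥_ Fin._>_ p q) →
                   IsReverseTableau T
  fromCompatible compat = All.tabulate λ p∈T → All.tabulate (compat p∈T)

  IsReverseTableau-↭ : ∀ {T T′ : Filling n} → T ↭ T′ → IsReverseTableau T → IsReverseTableau T′
  IsReverseTableau-↭ T↭T′ = Perm.All-resp-↭ T↭T′ ∘ All.map (Perm.All-resp-↭ T↭T′)

  -- The column of length n + 1 contains n + 1 different entries.
  column-too-long : ∀ {T : Filling n} → (∀ i → i ≤ n → (i , 0) ∈ boxes T) → ¬ IsReverseTableau T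
  column-too-long {T} column tab with ∈-map⁻ proj₁ (column 0 z≤n)
  ... | (_ , t) , 0,t∈T , ≡.refl = ℕ.<⇒≱ (Fin.toℕ<n t) (entry≥ n ≡.refl 0,t∈T)
    where
    entry≥ : ∀ d {i t} → i ℕ.+ d ≡ n → ((i , 0) , t) ∈ T → d ≤ toℕ t
    entry≥ zero    _      _  = z≤n
    entry≥ (suc d) {i} i+d≡n p∈T
      with ∈-map⁻ proj₁ (column (suc i) (ℕ.≤-trans (ℕ.m≤m+n (suc i) d)
             (ℕ.≤-reflexive (≡.trans (≡.sym (ℕ.+-suc i d)) i+d≡n))))
    ... | (_ , t′) , q∈T , ≡.refl = ℕ.≤-<-trans
      (entry≥ d (≡.trans (≡.sym (ℕ.+-suc i d)) i+d≡n) q∈T)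
      (proj₂ (compatible tab p∈T q∈T) ≡.refl ℕ.≤-refl)

extend : ∀ {n} → Diagram → Filling n → Filling (suc n)
extend u T = List.map (_, zero) u ++ List.map (Product.map₂ suc) T

module _ {n : ℕ} (u : Diagram) (T : Filling n) where

  private
    zero∈ : ∀ {α} → α ∈ u → (α , zero) ∈ extend u T
    zero∈ α∈u = ∈-++⁺ˡ (∈-map⁺ (_, zero) α∈u)

    suc∈ : ∀ {α t} → (α , t) ∈ T → (α , suc t) ∈ extend u T
    suc∈ p∈T = ∈-++⁺ʳ (List.map (_, zero) u) (∈-map⁺ (Product.map₂ suc) p∈T)

  extend⁻ : IsReverseTableau (extend u T) → IsReverseTableau T
  extend⁻ tab = fromCompatible λ p∈T q∈T →
    let row-cond , col-cond = compatible tab (suc∈ p∈T) (suc∈ q∈T)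
    in (λ i≡i′ c<c′ → ℕ.s≤s⁻¹ (row-cond i≡i′ c<c′)) , (λ c≡c′ i<i′ → ℕ.s≤s⁻¹ (col-cond c≡c′ i<i′))

  Clash⇒¬extend : Clash u (boxes T) → ¬ IsReverseTableau (extend u T)
  Clash⇒¬extend (row-clash α∈u β∈T c<c′) tab with ∈-map⁻ proj₁ β∈T
  ... | (_ , t) , p∈T , ≡.refl with proj₁ (compatible tab (zero∈ α∈u) (suc∈ p∈T)) ≡.refl c<c′
  ...   | ()
  Clash⇒¬extend (col-clash α∈u (inj₁ β∈u) i<i′) tab
    with proj₂ (compatible tab (zero∈ α∈u) (zero∈ β∈u)) ≡.refl i<i′
  ... | ()
  Clash⇒¬extend (col-clash α∈u (inj₂ β∈T) i<i′) tab with ∈-map⁻ proj₁ β∈T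
  ... | (_ , t) , p∈T , ≡.refl with proj₂ (compatible tab (zero∈ α∈u) (suc∈ p∈T)) ≡.refl i<i′
  ...   | ()

  extend⁺ : ¬ Clash u (boxes T) → IsReverseTableau T → IsReverseTableau (extend u T)
  extend⁺ ¬clash tab = fromCompatible λ p∈ q∈ → compat (split p∈) (split q∈)
    where
    data Entry : Box × Fin (suc n) → Set where
      new : ∀ {α} → α ∈ u → Entry (α , zero)
      old : ∀ {α t} → (α , t) ∈ T → Entry (α , suc t)

    split : ∀ {p} → p ∈ extend u T → Entry p
    split p∈ with ∈-++⁻ (List.map (_, zero) u) p∈
    ... | inj₁ p∈u with ∈-map⁻ (_, zero) p∈u
    ...   | _ , α∈u , ≡.refl = new α∈u
    split p∈ | inj₂ p∈T with ∈-map⁻ (Product.map₂ suc) p∈T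
    ...   | _ , q∈T , ≡.refl = old q∈T

    compat : ∀ {p q} → Entry p → Entry q → Compatible Fin._≥_ Fin._>_ p q
    compat (new α∈u) (new β∈u) =
      (λ _ _ → z≤n) ,
      (λ { ≡.refl i<i′ → ⊥-elim (¬clash (col-clash α∈u (inj₁ β∈u) i<i′)) })
    compat (new α∈u) (old q∈T) =
      (λ { ≡.refl c<c′ → ⊥-elim (¬clash (row-clash α∈u (∈-map⁺ proj₁ q∈T) c<c′)) }) ,
      (λ { ≡.refl i<i′ → ⊥-elim (¬clash (col-clash α∈u (inj₂ (∈-map⁺ proj₁ q∈T)) i<i′)) })
    compat (old p∈T) (new β∈u) = (λ _ _ → z≤n) , (λ _ _ → s≤s z≤n)
    compat (old p∈T) (old q∈T) =
      let row-cond , col-cond = compatible tab p∈T q∈T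
      in (λ i≡i′ c<c′ → s≤s (row-cond i≡i′ c<c′)) , (λ c≡c′ i<i′ → s≤s (col-cond c≡c′ i<i′))

-- Sums over tableaux

module TableauSums (R : CommutativeRing 0ℓ 0ℓ) where

  open CommutativeRing R hiding (zero)
  open RingOps R
  open Determinants R using (∑-cong)
  open RangeSums R
  open SetoidReasoning setoid
  open SemiringSolver commutativeSemiring
    using (solve; _:=_) renaming (_:+_ to _⊕_; _:*_ to _⊗_)

  module _ {A : Set} where

    ∑ₗ-cong : ∀ {xs : List A} {f g} → All (λ z → f z ≈ g z) xs → ∑ₗ xs f ≈ ∑ₗ xs g
    ∑ₗ-cong []        = refl
    ∑ₗ-cong (eq ∷ es) = +-cong eq (∑ₗ-cong es)

    ∑ₗ-zero : ∀ {xs : List A} {f} → All (λ z → f z ≈ 0#) xs → ∑ₗ xs f ≈ 0#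
    ∑ₗ-zero []        = refl
    ∑ₗ-zero (eq ∷ es) = trans (+-cong eq (∑ₗ-zero es)) (+-identityˡ 0#)

    ∑ₗ-*ˡ : ∀ z (xs : List A) f → ∑ₗ xs (λ z′ → z * f z′) ≈ z * ∑ₗ xs f
    ∑ₗ-*ˡ z []       f = sym (zeroʳ z)
    ∑ₗ-*ˡ z (_ ∷ xs) f = trans (+-congˡ (∑ₗ-*ˡ z xs f)) (sym (distribˡ z _ _))

    ∑ₗ-++ : ∀ (xs ys : List A) f → ∑ₗ (xs ++ ys) f ≈ ∑ₗ xs f + ∑ₗ ys f
    ∑ₗ-++ []       ys f = sym (+-identityˡ _)
    ∑ₗ-++ (z ∷ xs) ys f = trans (+-congˡ (∑ₗ-++ xs ys f)) (sym (+-assoc _ _ _))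

    ∏ₗ-++ : ∀ (xs ys : List A) f → ∏ₗ (xs ++ ys) f ≈ ∏ₗ xs f * ∏ₗ ys f
    ∏ₗ-++ []       ys f = sym (*-identityˡ _)
    ∏ₗ-++ (z ∷ xs) ys f = trans (*-congˡ (∏ₗ-++ xs ys f)) (sym (*-assoc _ _ _))

    ∏ₗ-↭ : ∀ {xs ys : List A} f → xs ↭ ys → ∏ₗ xs f ≈ ∏ₗ ys f
    ∏ₗ-↭ f Perm.refl         = refl
    ∏ₗ-↭ f (prep z p)        = *-congˡ (∏ₗ-↭ f p)
    ∏ₗ-↭ f (swap z z′ p)     = begin
      f z * (f z′ * _) ≈⟨ *-assoc _ _ _ ⟨
      f z * f z′ * _   ≈⟨ *-cong (*-comm _ _) (∏ₗ-↭ f p) ⟩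
      f z′ * f z * _   ≈⟨ *-assoc _ _ _ ⟩
      f z′ * (f z * _) ∎
    ∏ₗ-↭ f (Perm.trans p p′) = trans (∏ₗ-↭ f p) (∏ₗ-↭ f p′)

    ∑ₗ-filter : ∀ {P : A → Set} (P? : ∀ z → Dec (P z)) xs f →
                ∑ₗ (List.filter P? xs) f ≈ ∑ₗ xs (λ z → if does (P? z) then f z else 0#)
    ∑ₗ-filter P? []       f = refl
    ∑ₗ-filter P? (z ∷ xs) f with does (P? z)
    ... | true  = +-congˡ (∑ₗ-filter P? xs f)
    ... | false = trans (∑ₗ-filter P? xs f) (sym (+-identityˡ _))

  ∑ₗ-map : ∀ {A B : Set} (g : A → B) xs f → ∑ₗ (List.map g xs) f ≈ ∑ₗ xs (f ∘ g)
  ∑ₗ-map g []       f = refl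
  ∑ₗ-map g (z ∷ xs) f = +-congˡ (∑ₗ-map g xs f)

  ∏ₗ-map : ∀ {A B : Set} (g : A → B) xs f → ∏ₗ (List.map g xs) f ≈ ∏ₗ xs (f ∘ g)
  ∏ₗ-map g []       f = refl
  ∏ₗ-map g (z ∷ xs) f = *-congˡ (∏ₗ-map g xs f)

  -- Splitting fillings by the position of the smallest entry

  ∑ₗ-fillings-∷ : ∀ n α θ (H : Filling n → Carrier) →
    ∑ₗ (fillings n (α ∷ θ)) H ≈ ∑ λ t → ∑ₗ (fillings n θ) λ T → H ((α , t) ∷ T)
  ∑ₗ-fillings-∷ n α θ H = concatMap-tabulate id
    where
    concatMap-tabulate : ∀ {m} (g : Fin m → Fin n) →
      ∑ₗ (List.concatMap (λ t → List.map ((α , t) ∷_) (fillings n θ)) (List.tabulate g)) H ≈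
      ∑ λ i → ∑ₗ (fillings n θ) λ T → H ((α , g i) ∷ T)
    concatMap-tabulate {zero}  g = refl
    concatMap-tabulate {suc m} g = trans (∑ₗ-++ (List.map ((α , g zero) ∷_) (fillings n θ)) _ H)
      (+-cong (∑ₗ-map ((α , g zero) ∷_) (fillings n θ) H) (concatMap-tabulate (g ∘ suc)))

  fillings-boxes : ∀ n θ → All (λ T → boxes T ≡ θ) (fillings n θ)
  fillings-boxes n []      = ≡.refl ∷ []
  fillings-boxes n (α ∷ θ) = All.concat⁺ (All.map⁺ (All.universal
    (λ t → All.map⁺ (All.map (≡.cong (α ∷_)) (fillings-boxes n θ))) (List.allFin n)))

  -- Every box is put either into `u`, to hold the smallest entry, or into `v`. All splittings are
  -- summed; those that cannot come from a tableau are discarded later.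
  ∑split : Diagram → (Diagram → Diagram → Carrier) → Carrier
  ∑split []      K = K [] []
  ∑split (α ∷ θ) K = ∑split θ (λ u v → K (α ∷ u) v) + ∑split θ (λ u v → K u (α ∷ v))

  ∑split-cong : ∀ θ {K L} → (∀ u v → K u v ≈ L u v) → ∑split θ K ≈ ∑split θ L
  ∑split-cong []      e = e [] []
  ∑split-cong (α ∷ θ) e =
    +-cong (∑split-cong θ λ u v → e (α ∷ u) v) (∑split-cong θ λ u v → e u (α ∷ v))

  ∑split-zero : ∀ θ {K} → (∀ {u v} → Interleaving u v θ → K u v ≈ 0#) → ∑split θ K ≈ 0#
  ∑split-zero []      e = e []
  ∑split-zero (α ∷ θ) e = trans
    (+-cong (∑split-zero θ λ p → e (consˡ p)) (∑split-zero θ λ p → e (consʳ p)))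
    (+-identityˡ 0#)

  ∑split-+ : ∀ θ K L → ∑split θ K + ∑split θ L ≈ ∑split θ (λ u v → K u v + L u v)
  ∑split-+ []      K L = refl
  ∑split-+ (α ∷ θ) K L = trans
    (solve 4 (λ p q r s → (p ⊕ q) ⊕ (r ⊕ s) := (p ⊕ r) ⊕ (q ⊕ s)) refl _ _ _ _)
    (+-cong (∑split-+ θ _ _) (∑split-+ θ _ _))

  ∑-∑split : ∀ θ {n} (K : Fin n → Diagram → Diagram → Carrier) →
             ∑ (λ t → ∑split θ (K t)) ≈ ∑split θ (λ u v → ∑ λ t → K t u v)
  ∑-∑split θ {zero}  K = sym (∑split-zero θ λ _ → refl)
  ∑-∑split θ {suc n} K = trans (+-congˡ (∑-∑split θ (K ∘ suc))) (∑split-+ θ _ _)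

  ∑ₗ-fillings-suc : ∀ n θ {H : Filling (suc n) → Carrier} → (∀ {T T′} → T ↭ T′ → H T ≈ H T′) →
    ∑ₗ (fillings (suc n) θ) H ≈ ∑split θ λ u v → ∑ₗ (fillings n v) (H ∘ extend u)
  ∑ₗ-fillings-suc n []      inv = refl
  ∑ₗ-fillings-suc n (α ∷ θ) {H} inv = trans (∑ₗ-fillings-∷ (suc n) α θ H) (+-cong
    (∑ₗ-fillings-suc n θ (inv ∘ prep _))
    (begin
      ∑ (λ t → ∑ₗ (fillings (suc n) θ) λ T → H ((α , suc t) ∷ T))
        ≈⟨ ∑-cong (λ t → ∑ₗ-fillings-suc n θ (inv ∘ prep (α , suc t))) ⟩
      ∑ (λ t → ∑split θ λ u v → ∑ₗ (fillings n v) λ T → H ((α , suc t) ∷ extend u T))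
        ≈⟨ ∑-∑split θ (λ t u v → ∑ₗ (fillings n v) λ T → H ((α , suc t) ∷ extend u T)) ⟩
      ∑split θ (λ u v → ∑ λ t → ∑ₗ (fillings n v) λ T → H ((α , suc t) ∷ extend u T))
        -- The new box has a larger entry, so `extend` places it behind the block of smallest
        -- entries; moving it there is what needs the invariance of `H`.
        ≈⟨ ∑split-cong θ (λ u v → ∑-cong λ t → ∑ₗ-cong (All.universal (λ T →
             inv (↭-sym (Perm.shift (α , suc t) (List.map (_, zero) u) _))) (fillings n v))) ⟩
      ∑split θ (λ u v → ∑ λ t → ∑ₗ (fillings n v) λ T → H (extend u ((α , t) ∷ T)))
        ≈⟨ ∑split-cong θ (λ u v → ∑ₗ-fillings-∷ n α v (H ∘ extend u)) ⟨
      ∑split θ (λ u v → ∑ₗ (fillings n (α ∷ v)) (H ∘ extend u)) ∎))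

  -- The situation to the right of the first box of `u` in a row: a single splitting of the
  -- remaining boxes of that row survives.
  ∑split-cells-forced : ∀ i c m θ {K} → (∀ {u v c′} → (i , c′) ∈ v → c ≤ c′ → K u v ≈ 0#) →
    ∑split (cells i c m ++ θ) K ≈ ∑split θ (λ u v → K (cells i c m ++ u) v)
  ∑split-cells-forced i c zero    θ e = refl
  ∑split-cells-forced i c (suc m) θ e = trans
    (+-cong (∑split-cells-forced i (suc c) m θ λ c′∈ c<c′ → e c′∈ (ℕ.<⇒≤ c<c′))
            (∑split-zero (cells i (suc c) m ++ θ) λ _ → e (here ≡.refl) ℕ.≤-refl))
    (+-identityʳ _)

  -- No box of u may be followed by one of v in its row, so v contains the
  -- first k boxes of the row for some k.
  ∑split-cells : ∀ i c m θ {K} →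
    (∀ {u v c₁ c₂} → (i , c₁) ∈ u → (i , c₂) ∈ v → c₁ < c₂ → K u v ≈ 0#) →
    ∑split (cells i c m ++ θ) K ≈
    ∑range c m λ k → ∑split θ λ u v → K (cells i k ((c ℕ.+ m) ∸ k) ++ u) (cells i c (k ∸ c) ++ v)
  ∑split-cells i c zero θ e
    rewrite ℕ.m+n∸m≡n c 0 | ℕ.n∸n≡0 c = refl
  ∑split-cells i c (suc m) θ {K} e = +-cong
    (trans
      (∑split-cells-forced i (suc c) m θ λ c′∈ c<c′ → e (here ≡.refl) c′∈ c<c′)
      (reflexive (≡.cong₂ (λ p q → ∑split θ λ u v → K (cells i c p ++ u) (cells i c q ++ v))
        (≡.sym (ℕ.m+n∸m≡n c (suc m))) (≡.sym (ℕ.n∸n≡0 c)))))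
    (trans
      (∑split-cells i (suc c) m θ λ α∈ β∈ → e α∈ (there β∈))
      (∑range-cong (suc c) m λ k c<k _ → reflexive
        (≡.cong₂ (λ p q → ∑split θ λ u v → K (cells i k p ++ u) (q ++ v))
          (≡.cong (_∸ k) (≡.sym (ℕ.+-suc c m))) (first-cell c<k))))
    where
    first-cell : ∀ {c k} → c < k → (i , c) ∷ cells i (suc c) (k ∸ suc c) ≡ cells i c (k ∸ c)
    first-cell {c} {suc k} (s≤s c≤k) =
      ≡.cong (cells i c) (≡.sym (ℕ.+-∸-assoc 1 c≤k))

  -- The sum over the diagrams interlacing with ν that have the same number of rows.
  ∑int : ∀ {n} → Vec ℕ n → (Vec ℕ n → Carrier) → Carrier
  ∑int []      G = G []
  ∑int (r ∷ ν) G = ∑range (first ν) (r ∸ first ν) λ k → ∑int ν (G ∘ (k ∷_))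

  ∑int-cong : ∀ {n} {ν : Vec ℕ n} → Decreasing ν → ∀ {G H} →
              (∀ {μ} → Interlacing ν μ → G μ ≈ H μ) → ∑int ν G ≈ ∑int ν H
  ∑int-cong {ν = []}    _         e = e []
  ∑int-cong {ν = r ∷ ν} (ν≤r ∷ D) e = ∑range-cong (first ν) (r ∸ first ν) λ k ν≤k k≤ →
    ∑int-cong D λ lace → e ((ν≤k , ≡.subst (k ≤_) (ℕ.m+[n∸m]≡n ν≤r) k≤) ∷ lace)

  -- Row clashes leave in `v` only the first `k` boxes of the row. If `k` is less than the length of
  -- the next row, the box in column `k` belongs to `u` and has a box of `ν` directly below it,
  -- which is a column clash.
  ∑split-diagram : ∀ {n} i {ν : Vec ℕ n} → Decreasing ν → ∀ {K} →
    (∀ {u v} → Clash u v → K u v ≈ 0#) →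
    ∑split (diagram i ν) K ≈ ∑int ν λ μ → K (outside i ν μ) (diagram i μ)
  ∑split-diagram i {[]}    _         e = refl
  ∑split-diagram i {r ∷ ν} (ν≤r ∷ D) {K} e = begin
    ∑split (cells i 0 r ++ diagram (suc i) ν) K
      ≈⟨ ∑split-cells i 0 r (diagram (suc i) ν) (λ α∈ β∈ c<c′ → e (row-clash α∈ β∈ c<c′)) ⟩
    ∑range 0 r summand
      ≡⟨ ≡.cong (λ s → ∑range 0 s summand) (≡.sym (ℕ.m+[n∸m]≡n ν≤r)) ⟩
    ∑range 0 (first ν ℕ.+ (r ∸ first ν)) summand
      ≈⟨ ∑range-drop 0 (first ν) (r ∸ first ν) short ⟩
    ∑range (first ν) (r ∸ first ν) summand
      ≈⟨ ∑range-cong (first ν) (r ∸ first ν) (λ k _ _ →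
           ∑split-diagram (suc i) D (e ∘ Clash-++ (cells i k (r ∸ k)) (cells i 0 k))) ⟩
    ∑int (r ∷ ν) (λ μ → K (outside i (r ∷ ν) μ) (diagram i μ)) ∎
    where
    summand : ℕ → Carrier
    summand k = ∑split (diagram (suc i) ν) λ u v → K (cells i k (r ∸ k) ++ u) (cells i 0 k ++ v)

    short : ∀ k → k < first ν → summand k ≈ 0#
    short k k<ν = ∑split-zero (diagram (suc i) ν) λ {u} {v} p → e (col-clash
      (∈-++⁺ˡ (∈-cells⁺ i (r ∸ k) ℕ.≤-refl
        (≡.subst (k <_) (≡.sym (ℕ.m+[n∸m]≡n k≤r)) (ℕ.<-≤-trans k<ν ν≤r))))
      (below (∈-++⁻ u (Perm.∈-resp-↭ (toPermutation p) box)))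
      ℕ.≤-refl)
      where
      k≤r : k ≤ r
      k≤r = ℕ.≤-trans (ℕ.<⇒≤ k<ν) ν≤r

      box : (suc i , k) ∈ diagram (suc i) ν
      box = ≡.subst (λ j → (j , k) ∈ diagram (suc i) ν) (ℕ.+-identityʳ (suc i))
        (∈-diagram⁺ (suc i) ν 0 (≡.subst (k <_) (first≡partᵛ-0 ν) k<ν))

      below : ∀ {u v} → (suc i , k) ∈ u ⊎ (suc i , k) ∈ v →
              (suc i , k) ∈ cells i k (r ∸ k) ++ u ⊎ (suc i , k) ∈ cells i 0 k ++ v
      below (inj₁ β∈u) = inj₁ (∈-++⁺ʳ (cells i k (r ∸ k)) β∈u)
      below (inj₂ β∈v) = inj₂ (∈-++⁺ʳ (cells i 0 k) β∈v)

  -- Weighted sums over reverse tableaux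

  module _ {n : ℕ} (w : Box → Fin n → Carrier) where

    weight : Filling n → Carrier
    weight T = ∏ₗ T λ (α , t) → w α t

    weight? : Filling n → Carrier
    weight? T = if does (isReverseTableau? T) then weight T else 0#

    weight?-yes : ∀ {T} → IsReverseTableau T → weight? T ≈ weight T
    weight?-yes {T} tab with isReverseTableau? T
    ... | yes _   = refl
    ... | no ¬tab = ⊥-elim (¬tab tab)

    weight?-no : ∀ {T} → ¬ IsReverseTableau T → weight? T ≈ 0#
    weight?-no {T} ¬tab with isReverseTableau? T
    ... | yes tab = ⊥-elim (¬tab tab)
    ... | no _    = refl

    weight?-↭ : ∀ {T T′} → T ↭ T′ → weight? T ≈ weight? T′
    weight?-↭ {T} T↭T′ with isReverseTableau? T
    ... | yes tab = trans (∏ₗ-↭ _ T↭T′) (sym (weight?-yes (IsReverseTableau-↭ T↭T′ tab)))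
    ... | no ¬tab = sym (weight?-no (¬tab ∘ IsReverseTableau-↭ (↭-sym T↭T′)))

    tableauSum : Diagram → Carrier
    tableauSum θ = ∑ₗ (reverseTableaux n θ) weight

    tableauSum-fillings : ∀ θ → tableauSum θ ≈ ∑ₗ (fillings n θ) weight?
    tableauSum-fillings θ = ∑ₗ-filter isReverseTableau? (fillings n θ) weight

    tableauSum-zero : ∀ θ → (∀ i → i ≤ n → (i , 0) ∈ θ) → tableauSum θ ≈ 0#
    tableauSum-zero θ column = trans (tableauSum-fillings θ) (∑ₗ-zero (All.map
      (λ { {T} ≡.refl → weight?-no {T} (column-too-long column) }) (fillings-boxes n θ)))

  module _ {n : ℕ} (w : Box → Fin (suc n) → Carrier) where

    private
      w₊ : Box → Fin n → Carrier
      w₊ α t = w α (suc t)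

    weight-extend : ∀ u T → weight w (extend u T) ≈ ∏ₗ u (λ α → w α zero) * weight w₊ T
    weight-extend u T = trans (∏ₗ-++ (List.map (_, zero) u) _ _)
      (*-cong (∏ₗ-map (_, zero) u _) (∏ₗ-map (Product.map₂ suc) T _))

    weight?-extend : ∀ u {T} → ¬ Clash u (boxes T) →
                     weight? w (extend u T) ≈ ∏ₗ u (λ α → w α zero) * weight? w₊ T
    weight?-extend u {T} ¬clash with isReverseTableau? T
    ... | yes tab = trans (weight?-yes w (extend⁺ u T ¬clash tab)) (weight-extend u T)
    ... | no ¬tab = trans (weight?-no w (¬tab ∘ extend⁻ u T)) (sym (zeroʳ _))

    -- The number `m` of rows is independent of the number of entries. Diagrams too tall for the
    -- remaining entries are still in the sum; their tableau sums vanish.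
    tableauSum-branching : ∀ {m} {ν : Vec ℕ m} → Decreasing ν →
      tableauSum w (diagram 0 ν) ≈
      ∑int ν λ μ → ∏ₗ (outside 0 ν μ) (λ α → w α zero) * tableauSum w₊ (diagram 0 μ)
    tableauSum-branching {ν = ν} D = begin
      tableauSum w (diagram 0 ν)
        ≈⟨ tableauSum-fillings w (diagram 0 ν) ⟩
      ∑ₗ (fillings (suc n) (diagram 0 ν)) (weight? w)
        ≈⟨ ∑ₗ-fillings-suc n (diagram 0 ν) (weight?-↭ w) ⟩
      ∑split (diagram 0 ν) (λ u v → ∑ₗ (fillings n v) (weight? w ∘ extend u))
        ≈⟨ ∑split-diagram 0 D (λ {u} {v} clash → ∑ₗ-zero (All.map
             (λ { {T} ≡.refl → weight?-no w (Clash⇒¬extend u T clash) }) (fillings-boxes n v))) ⟩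
      ∑int ν (λ μ → ∑ₗ (fillings n (diagram 0 μ)) (weight? w ∘ extend (outside 0 ν μ)))
        ≈⟨ ∑int-cong D (λ {μ} lace → begin
             ∑ₗ (fillings n (diagram 0 μ)) (weight? w ∘ extend (outside 0 ν μ))
               ≈⟨ ∑ₗ-cong (All.map (λ {T} eq → weight?-extend (outside 0 ν μ) {T}
                    (≡.subst (¬_ ∘ Clash _) (≡.sym eq) (Interlacing⇒¬Clash lace)))
                    (fillings-boxes n (diagram 0 μ))) ⟩
             ∑ₗ (fillings n (diagram 0 μ)) (λ T → ∏ₗ (outside 0 ν μ) _ * weight? w₊ T)
               ≈⟨ ∑ₗ-*ˡ _ (fillings n (diagram 0 μ)) (weight? w₊) ⟩
             ∏ₗ (outside 0 ν μ) _ * ∑ₗ (fillings n (diagram 0 μ)) (weight? w₊)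
               ≈⟨ *-congˡ (tableauSum-fillings w₊ (diagram 0 μ)) ⟨
             ∏ₗ (outside 0 ν μ) _ * tableauSum w₊ (diagram 0 μ) ∎) ⟩
      ∑int ν (λ μ → ∏ₗ (outside 0 ν μ) (λ α → w α zero) * tableauSum w₊ (diagram 0 μ)) ∎

-- Tableau sums as quotients of determinants

diagram-∷ʳ-0 : ∀ {n} i (μ : Vec ℕ n) → diagram i (μ Vec.∷ʳ 0) ≡ diagram i μ
diagram-∷ʳ-0 i []      = ≡.refl
diagram-∷ʳ-0 i (k ∷ μ) = ≡.cong (cells i 0 k ++_) (diagram-∷ʳ-0 (suc i) μ)

Decreasing-∷ʳ⁻ : ∀ {n k} {μ : Vec ℕ n} → Decreasing (μ Vec.∷ʳ k) → Decreasing μ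
Decreasing-∷ʳ⁻ {μ = []}         _         = []
Decreasing-∷ʳ⁻ {μ = _ ∷ []}     _         = z≤n ∷ []
Decreasing-∷ʳ⁻ {μ = _ ∷ _ ∷ _} (μ≤r ∷ D) = μ≤r ∷ Decreasing-∷ʳ⁻ D

module FactorialTableaux (R : CommutativeRing 0ℓ 0ℓ) (β : ℕ → CommutativeRing.Carrier R) where

  open CommutativeRing R hiding (zero)
  open RingOps R
  open Determinants R
  open RangeSums R
  open TableauSums R
  open FactorialPowers R β
  open SetoidReasoning setoid
  open SemiringSolver commutativeSemiring
    using (solve; _:=_) renaming (_:+_ to _⊕_; _:*_ to _⊗_)

  ∏-cong : ∀ {n} {f g : Fin n → Carrier} → (∀ i → f i ≈ g i) → ∏ f ≈ ∏ g
  ∏-cong {zero}  e = refl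
  ∏-cong {suc n} e = *-cong (e zero) (∏-cong (e ∘ suc))

  vandermonde-suc : ∀ {n} (X : Fin (suc n) → Carrier) →
    vandermonde X ≈ ∏ (λ i → X zero - X (suc i)) * vandermonde (X ∘ suc)
  vandermonde-suc X = *-cong (*-identityˡ _) (∏-cong {f = λ i → 1# * factors i} λ i → *-identityˡ (factors i))
    where
    factors : _ → Carrier
    factors i = ∏ λ j → if does (i Fin.<? j) then X (suc i) - X (suc j) else 1#

  -- The two sums differ only in the bottom row of `μ`, which runs from 0 to that of `ν` in `∑int`
  -- and is missing in `∑lace`.
  ∑int-∑lace : ∀ {n} {ν : Vec ℕ (suc n)} → Decreasing ν → ∀ {G} →
    (∀ {μ} → Interlacing ν μ → 0 < Vec.last μ → G μ ≈ 0#) →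
    ∑int ν G ≈ ∑lace ν (λ μ → G (μ Vec.∷ʳ 0))
  ∑int-∑lace {ν = zero ∷ []}  _ e = refl
  ∑int-∑lace {ν = suc r ∷ []} _ {G} e = begin
    G (0 ∷ []) + ∑range 1 r (λ k → G (k ∷ []))
      -- Zero is written as a product so that `∑range-*ˡ` can take a factor 0 out of the sum.
      ≈⟨ +-congˡ (∑range-cong 1 r {g = λ k → 0# * 0#} λ k 0<k k≤ →
           trans (e ((z≤n , k≤) ∷ []) 0<k) (sym (zeroˡ 0#))) ⟩
    G (0 ∷ []) + ∑range 1 r (λ k → 0# * 0#)
      ≈⟨ +-congˡ (trans (∑range-*ˡ 0# 1 r _) (zeroˡ _)) ⟩
    G (0 ∷ []) + 0#  ≈⟨ +-identityʳ _ ⟩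
    G (0 ∷ [])       ∎
  ∑int-∑lace {ν = r ∷ ν@(r′ ∷ _)} (r′≤r ∷ D) {G} e = ∑range-cong r′ (r ∸ r′) λ k r′≤k k≤ →
    ∑int-∑lace D {G ∘ (k ∷_)} λ { {_ ∷ _} lace 0<last →
      e ((r′≤k , ≡.subst (k ≤_) (ℕ.m+[n∸m]≡n r′≤r) k≤) ∷ lace) 0<last }

  ∏ₗ-cells : ∀ {z m i} {ω : Box → Carrier} → (∀ c → ω (i , c) ≈ z - β (m ℕ.+ c)) →
             ∀ c q → ∏ₗ (cells i c q) ω ≈ factorial z (m ℕ.+ c) q
  ∏ₗ-cells {m = m} e c zero    = refl
  ∏ₗ-cells {z} {m} e c (suc q) = *-cong (e c)
    (trans (∏ₗ-cells e (suc c) q) (reflexive (≡.cong (λ l → factorial z l q) (ℕ.+-suc m c))))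

  ∏ₗ-outside : ∀ {z n ω} → (∀ i c d → i ℕ.+ d ≡ n → ω (i , c) ≈ z - β (d ℕ.+ c)) →
    ∀ {m} i (ν : Vec ℕ (suc m)) μ → i ℕ.+ m ≡ n →
    ∏ₗ (outside i ν (μ Vec.∷ʳ 0)) ω ≈ laceWeight z ν μ
  ∏ₗ-outside {ω = ω} e i (r ∷ []) [] i+m≡n = begin
    ∏ₗ (cells i 0 r ++ []) ω   ≈⟨ ∏ₗ-++ (cells i 0 r) [] ω ⟩
    ∏ₗ (cells i 0 r) ω * 1#    ≈⟨ *-identityʳ _ ⟩
    ∏ₗ (cells i 0 r) ω         ≈⟨ ∏ₗ-cells (λ c → e i c 0 i+m≡n) 0 r ⟩
    factorial _ 0 r            ∎
  ∏ₗ-outside {ω = ω} e {suc m} i (r ∷ ν@(_ ∷ _)) (k ∷ μ) i+m≡n = trans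
    (∏ₗ-++ (cells i k (r ∸ k)) _ ω)
    (*-cong (∏ₗ-cells (λ c → e i c (suc m) i+m≡n) k (r ∸ k))
            (∏ₗ-outside e (suc i) ν μ (≡.trans (≡.sym (ℕ.+-suc i m)) i+m≡n)))

  -- In a reverse tableau of straight shape the i boxes above a box in row i have larger entries, so
  -- i + suc t ≤ n, and `d` is the difference. It stays the same when the first variable is dropped,
  -- since n and t both decrease by one; hence one sequence `β` serves the whole induction.
  FactorialWeights : ∀ n → (Fin n → Carrier) → (Box → Fin n → Carrier) → Set
  FactorialWeights n X w = ∀ i c t d → i ℕ.+ suc (toℕ t) ℕ.+ d ≡ n →
                           w (i , c) t ≈ X t - β (d ℕ.+ c)

  vandermonde-tableauSum : ∀ n {ν : Vec ℕ n} → Decreasing ν → ∀ {X w} → FactorialWeights n X w →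
    vandermonde X * tableauSum w (diagram 0 ν) ≈ detᶜ n (columns X ν)
  vandermonde-tableauSum zero    {[]} D fw = trans (*-identityˡ _) (+-identityʳ _)
  vandermonde-tableauSum (suc n) {ν}  D {X} {w} fw = begin
    vandermonde X * tableauSum w (diagram 0 ν)
      ≈⟨ *-cong (vandermonde-suc X) (trans (tableauSum-branching w D) (∑int-∑lace D bottom-row)) ⟩
    P * V * ∑lace ν (λ μ → summand (μ Vec.∷ʳ 0))
      ≈⟨ *-assoc _ _ _ ⟩
    P * (V * ∑lace ν (λ μ → summand (μ Vec.∷ʳ 0)))
      ≈⟨ *-congˡ (∑lace-*ˡ V ν _) ⟨
    P * ∑lace ν (λ μ → V * summand (μ Vec.∷ʳ 0))
      ≈⟨ *-congˡ (∑lace-cong ν D inductive-step) ⟩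
    P * ∑lace ν (λ μ → laceWeight (X zero) ν μ * detᶜ n (columns (X ∘ suc) μ))
      ≈⟨ detᶜ-columns-branching X ν D ⟩
    detᶜ (suc n) (columns X ν) ∎
    where
    P = ∏ λ i → X zero - X (suc i)
    V = vandermonde (X ∘ suc)

    w₊ : Box → Fin n → Carrier
    w₊ α t = w α (suc t)

    summand : Vec ℕ (suc n) → Carrier
    summand μ = ∏ₗ (outside 0 ν μ) (λ α → w α zero) * tableauSum w₊ (diagram 0 μ)

    -- Here all n + 1 rows of `μ` are nonempty, and only n values are left for its first column.
    bottom-row : ∀ {μ} → Interlacing ν μ → 0 < Vec.last μ → summand μ ≈ 0#
    bottom-row {μ} lace 0<last = trans
      (*-congˡ (tableauSum-zero w₊ (diagram 0 μ) λ i i≤n →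
        ∈-diagram⁺ 0 μ i (ℕ.<-≤-trans 0<last (last≤partᵛ (Interlacing⇒Decreasing lace) i i≤n))))
      (zeroʳ _)

    first-weights : ∀ i c d → i ℕ.+ d ≡ n → w (i , c) zero ≈ X zero - β (d ℕ.+ c)
    first-weights i c d i+d≡n =
      fw i c zero d (≡.trans (≡.cong (ℕ._+ d) (ℕ.+-comm i 1)) (≡.cong suc i+d≡n))

    later-weights : FactorialWeights n (X ∘ suc) w₊
    later-weights i c t d e =
      fw i c (suc t) d (≡.trans (≡.cong (ℕ._+ d) (ℕ.+-suc i (suc (toℕ t)))) (≡.cong suc e))

    inductive-step : ∀ μ → Interlacing ν (μ Vec.∷ʳ 0) →
      V * summand (μ Vec.∷ʳ 0) ≈ laceWeight (X zero) ν μ * detᶜ n (columns (X ∘ suc) μ)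
    inductive-step μ lace = begin
      V * summand (μ Vec.∷ʳ 0)
        ≈⟨ *-congˡ (*-cong (∏ₗ-outside first-weights 0 ν μ ≡.refl)
             (reflexive (≡.cong (tableauSum w₊) (diagram-∷ʳ-0 0 μ)))) ⟩
      V * (laceWeight (X zero) ν μ * tableauSum w₊ (diagram 0 μ))
        ≈⟨ solve 3 (λ p q f → p ⊗ (q ⊗ f) := q ⊗ (p ⊗ f)) refl V _ _ ⟩
      laceWeight (X zero) ν μ * (V * tableauSum w₊ (diagram 0 μ))
        ≈⟨ *-congˡ (vandermonde-tableauSum n
             (Decreasing-∷ʳ⁻ (Interlacing⇒Decreasing lace)) later-weights) ⟩
      laceWeight (X zero) ν μ * detᶜ n (columns (X ∘ suc) μ) ∎

-- The evaluation y = -a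

rows : List ℕ → ∀ n → Vec ℕ n
rows ν n = tabulate {n = n} (part ν ∘ toℕ)

rows-Decreasing : ∀ {ν} → Linked _≥_ ν → ∀ n → Decreasing (rows ν n)
rows-Decreasing _                   zero          = []
rows-Decreasing []                  (suc zero)    = z≤n ∷ []
rows-Decreasing []                  (suc (suc n)) = z≤n ∷ rows-Decreasing [] (suc n)
rows-Decreasing [-]                 (suc zero)    = z≤n ∷ []
rows-Decreasing [-]                 (suc (suc n)) = z≤n ∷ rows-Decreasing [] (suc n)
rows-Decreasing (_ ∷ _)             (suc zero)    = z≤n ∷ []
rows-Decreasing (r≥r′ ∷ decreasing) (suc (suc n)) = r≥r′ ∷ rows-Decreasing decreasing (suc n)

partᵛ-rows : ∀ ν {n d} → d < n → partᵛ (rows ν n) d ≡ part ν d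
partᵛ-rows ν       {suc n} {zero}  _         = ≡.refl
partᵛ-rows []      {suc n} {suc d} (s≤s d<n) = partᵛ-rows [] d<n
partᵛ-rows (r ∷ ν) {suc n} {suc d} (s≤s d<n) = partᵛ-rows ν d<n

diagram-rows-[] : ∀ i n → diagram i (rows [] n) ≡ []
diagram-rows-[] i zero    = ≡.refl
diagram-rows-[] i (suc n) = diagram-rows-[] (suc i) n

skew-[] : ∀ ν {n} → length ν ≤ n → skew ν [] ≡ diagram 0 (rows ν n)
skew-[] ν {n} ℓ≤n = rows-from ν 0 id ℓ≤n (λ _ → ≡.refl) whole-row
  where
  boxesOfRow : ℕ → Diagram
  boxesOfRow i = List.map (i ,_) (List.filter (part [] i ℕ.≤?_) (List.upTo (part ν i)))

  map-applyUpTo : ∀ i c m f → (∀ k → f k ≡ c ℕ.+ k) →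
                  List.map (i ,_) (List.applyUpTo f m) ≡ cells i c m
  map-applyUpTo i c zero    f e = ≡.refl
  map-applyUpTo i c (suc m) f e = ≡.cong₂ _∷_
    (≡.cong (i ,_) (≡.trans (e 0) (ℕ.+-identityʳ c)))
    (map-applyUpTo i (suc c) m (f ∘ suc) λ k → ≡.trans (e (suc k)) (ℕ.+-suc c k))

  whole-row : ∀ i → boxesOfRow i ≡ cells i 0 (part ν i)
  whole-row i = ≡.trans
    (≡.cong (List.map (i ,_)) (List.filter-all (part [] i ℕ.≤?_)
      (All.universal (λ _ → z≤n) (List.upTo (part ν i)))))
    (map-applyUpTo i 0 (part ν i) id λ _ → ≡.refl)

  rows-from : ∀ ρ {n} i f → length ρ ≤ n → (∀ d → f d ≡ i ℕ.+ d) →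
    (∀ d → boxesOfRow (i ℕ.+ d) ≡ cells (i ℕ.+ d) 0 (part ρ d)) →
    List.concatMap boxesOfRow (List.applyUpTo f (length ρ)) ≡ diagram i (rows ρ n)
  rows-from []      {n}     i f _         f≡ row≡ = ≡.sym (diagram-rows-[] i n)
  rows-from (r ∷ ρ) {suc n} i f (s≤s ℓ≤n) f≡ row≡ = ≡.cong₂ _++_
    (≡.trans (≡.cong boxesOfRow (f≡ 0)) (≡.trans (row≡ 0)
      (≡.cong (λ j → cells j 0 r) (ℕ.+-identityʳ i))))
    (rows-from ρ (suc i) (f ∘ suc) ℓ≤n (λ d → ≡.trans (f≡ (suc d)) (ℕ.+-suc i d))
      λ d → ≡.subst (λ j → boxesOfRow j ≡ cells j 0 (part ρ d)) (ℕ.+-suc i d) (row≡ (suc d)))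

part-positive : ∀ {ν} → All (0 <_) ν → ∀ {i} → i < length ν → 0 < part ν i
part-positive (0<r ∷ pos) {zero}  _         = 0<r
part-positive (0<r ∷ pos) {suc i} (s≤s i<ℓ) = part-positive pos i<ℓ

module _ (R S : CommutativeRing 0ℓ 0ℓ) where

  private
    module R where
      open CommutativeRing R public
      open RingOps R public
    module S where
      open CommutativeRing S public
      open RingOps S public

  module _ {h : R.Carrier → S.Carrier} (h-isHom : IsHom R S h) where

    private module h = IsRingHomomorphism h-isHom

    hom-∑ₗ : ∀ {A : Set} (xs : List A) {f g} → (∀ z → h (f z) S.≈ g z) →
             h (R.∑ₗ xs f) S.≈ S.∑ₗ xs g
    hom-∑ₗ []       e = h.0#-homo
    hom-∑ₗ (z ∷ xs) e = S.trans (h.+-homo _ _) (S.+-cong (e z) (hom-∑ₗ xs e))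

    hom-∏ₗ : ∀ {A : Set} (xs : List A) {f g} → (∀ z → h (f z) S.≈ g z) →
             h (R.∏ₗ xs f) S.≈ S.∏ₗ xs g
    hom-∏ₗ []       e = h.1#-homo
    hom-∏ₗ (z ∷ xs) e = S.trans (h.*-homo _ _) (S.*-cong (e z) (hom-∏ₗ xs e))

index-content : ∀ {n} i c (t : Fin n) d → i ℕ.+ suc (toℕ t) ℕ.+ d ≡ n →
                index t ℤ.- content (i , c) ≡ n ⊖ (d ℕ.+ c)
index-content {n} i c t d eq = begin
  + suc (toℕ t) ℤ.- (c ⊖ i)          ≡⟨ ≡.cong (ℤ._+_ (+ suc (toℕ t))) (ℤ.⊖-swap i c) ⟨
  + suc (toℕ t) ℤ.+ (i ⊖ c)          ≡⟨ ℤ.distribʳ-⊖-+-pos (suc (toℕ t)) i c ⟩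
  (suc (toℕ t) ℕ.+ i) ⊖ c            ≡⟨ ℤ.+-cancelˡ-⊖ d _ c ⟨
  (d ℕ.+ (suc (toℕ t) ℕ.+ i)) ⊖ (d ℕ.+ c)
    ≡⟨ ≡.cong (_⊖ (d ℕ.+ c)) (≡.trans (ℕ.+-comm d _)
         (≡.trans (≡.cong (ℕ._+ d) (ℕ.+-comm _ i)) eq)) ⟩
  n ⊖ (d ℕ.+ c) ∎
  where open ≡.≡-Reasoning

module _ (n : ℕ) where

  private
    A = ℚ[a][x/y] n
    B = ℚ[a][x] n

  open CommutativeRing (ℚ[a][x] n) hiding (zero)
  open RingOps (ℚ[a][x] n)
  open Determinants (ℚ[a][x] n)
  open TableauSums (ℚ[a][x] n)
  open FactorialPowers (ℚ[a][x] n) (λ k → con (a (n ⊖ k)))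
  open FactorialTableaux (ℚ[a][x] n) (λ k → con (a (n ⊖ k)))
  open SetoidReasoning setoid

  private
    ev : CommutativeRing.Carrier A → Carrier
    ev = evaluate-y=-aₙ n

    ev-isHom : IsHom A (ℚ[a][x] n) ev
    ev-isHom = evaluate-isHom n

    module ev = IsRingHomomorphism ev-isHom

  doubleWeight : Box → Fin n → Carrier
  doubleWeight α t = var t - con (a (index t ℤ.- content α))

  evaluate-s̃ : ∀ θ → ev (s̃ n θ) ≈ tableauSum doubleWeight θ
  evaluate-s̃ θ = hom-∑ₗ A B ev-isHom (reverseTableaux n θ) λ T → hom-∏ₗ A B ev-isHom T λ _ → refl

  evaluate-s[y∣-a] : ∀ θ → ev (s[y∣-a] n ((0 , 0) ∷ θ)) ≈ 0#
  evaluate-s[y∣-a] θ = trans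
    (hom-∑ₗ A B ev-isHom (semistandard n ((0 , 0) ∷ θ)) (λ _ → refl))
    (∑ₗ-zero (All.filter⁺ _ (All.concat⁺ (All.map⁺ (All.universal
      (λ t → All.map⁺ (All.universal (λ T → factor t T) (fillings n θ))) (List.allFin n))))))
    where
    factor : ∀ t (T : Filling n) → ev (RingOps.∏ₗ A (((0 , 0) , t) ∷ T) λ (α , s) →
               CommutativeRing._+_ A (var (y s)) (con (a (index s ℤ.+ content α)))) ≈ 0#
    factor t T = trans
      (*-congʳ (trans
        (+-congˡ (reflexive (≡.cong (λ k → con (a k)) (ℤ.+-identityʳ (index t)))))
        (-‿inverseˡ _)))
      (zeroˡ _)

  evaluate-superSchur : ∀ ν → ev (superSchurₙ n ν []) ≈ tableauSum doubleWeight (skew ν [])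
  evaluate-superSchur ν = begin
    ev (superSchurₙ n ν [])
      ≈⟨ hom-∑ₗ A B ev-isHom (between [] ν) (λ ρ →
           ev.*-homo (s̃ n (skew ν ρ)) (s[y∣-a] n (conjugate (skew ρ [])))) ⟩
    ∑ₗ (between [] ν) summand
      ≈⟨ empty-only ν ⟩
    ev (s̃ n (skew ν [])) * ev (s[y∣-a] n [])
      ≈⟨ *-cong (evaluate-s̃ (skew ν [])) (trans (+-identityʳ _) refl) ⟩
    tableauSum doubleWeight (skew ν []) * 1#
      ≈⟨ *-identityʳ _ ⟩
    tableauSum doubleWeight (skew ν []) ∎
    where
    summand : List ℕ → Carrier
    summand ρ = ev (s̃ n (skew ν ρ)) * ev (s[y∣-a] n (conjugate (skew ρ [])))

    empty-only : ∀ κ → ∑ₗ (between [] κ) summand ≈ summand []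
    empty-only []       = +-identityʳ _
    empty-only (k ∷ ks) = trans
      (+-congˡ (∑ₗ-zero (All.filter⁺ ([] ⊆?_) (All.filter⁺ _ (All.concat⁺ (All.map⁺ (All.universal
        (λ r → All.map⁺ (All.universal (λ ρ →
          -- Every list in `bounded` after the first begins with some `suc r`, so its diagram
          -- computes to a list headed by the box (0 , 0); `List.drop 1` names the rest.
          trans (*-congˡ (evaluate-s[y∣-a] (List.drop 1 (conjugate (skew (suc r ∷ ρ) []))))) (zeroʳ _)) (bounded ks))) (List.upTo k))))))))
      (+-identityʳ _)

  doubleWeight-FactorialWeights : FactorialWeights n var doubleWeight
  doubleWeight-FactorialWeights i c t d eq =
    reflexive (≡.cong (λ k → var t - con (a k)) (index-content i c t d eq))

  columns-rows : ∀ {m} {I : Set} (X : I → Carrier) (f : Fin m → ℕ) →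
    columns X (tabulate f) ≡ tabulate λ j i → factorial (X i) 0 ((m ∸ suc (toℕ j)) ℕ.+ f j)
  columns-rows {zero}  X f = ≡.refl
  columns-rows {suc m} X f = ≡.cong (_ ∷_) (columns-rows X (f ∘ suc))

  power≈factorial : ∀ z r → ⟨_‖a⟩^_ n z r ≈ factorial z 0 r
  power≈factorial z r = from 0 r (λ k → toℕ k) λ _ → ≡.refl
    where
    from : ∀ l q (e : Fin q → ℕ) → (∀ k → e k ≡ l ℕ.+ toℕ k) →
           ∏ (λ k → z - con (a (n ⊖ e k))) ≈ factorial z l q
    from l zero    e e≡ = refl
    from l (suc q) e e≡ = *-cong
      (reflexive (≡.cong (λ k → z - con (a (n ⊖ k))) (≡.trans (e≡ zero) (ℕ.+-identityʳ l))))
      (from (suc l) q (e ∘ suc) λ k → ≡.trans (e≡ (suc k)) (ℕ.+-suc l (toℕ k)))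

  det≈detᶜ-columns : ∀ ν →
    det (λ i j → ⟨_‖a⟩^_ n (var i) (part ν (toℕ j) ℕ.+ (n ∸ suc (toℕ j)))) ≈
    detᶜ n (columns var (rows ν n))
  det≈detᶜ-columns ν = begin
    det power
      ≈⟨ det≈detᶜ power ⟩
    detᶜ n (tabulate λ j i → power i j)
      ≈⟨ Linear-cong (detᶜ-linear n) (tabulate⁺ λ j i → trans
           (power≈factorial (var i) (part ν (toℕ j) ℕ.+ (n ∸ suc (toℕ j))))
           (reflexive (≡.cong (factorial (var i) 0)
             (ℕ.+-comm (part ν (toℕ j)) (n ∸ suc (toℕ j)))))) ⟩
    detᶜ n (tabulate λ j i → factorial (var i) 0 ((n ∸ suc (toℕ j)) ℕ.+ part ν (toℕ j)))
      ≡⟨ ≡.cong (detᶜ n) (columns-rows var (part ν ∘ toℕ)) ⟨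
    detᶜ n (columns var (rows ν n)) ∎
    where
    power : Fin n → Fin n → Carrier
    power i j = ⟨_‖a⟩^_ n (var i) (part ν (toℕ j) ℕ.+ (n ∸ suc (toℕ j)))

proposition2p5 : (ν : Partition) → superSchur ν ∣y=-a ≋ doubleSchur ν
proposition2p5 ν n with ℓ ν ℕ.≤? n
... | yes ℓ≤n = begin
  evaluate-y=-aₙ n (superSchur ν n) * vandermonde var
    ≈⟨ *-congʳ (evaluate-superSchur n parts) ⟩
  tableauSum (doubleWeight n) (skew parts []) * vandermonde var
    ≈⟨ *-comm _ _ ⟩
  vandermonde var * tableauSum (doubleWeight n) (skew parts [])
    ≡⟨ ≡.cong (λ θ → vandermonde var * tableauSum (doubleWeight n) θ) (skew-[] parts ℓ≤n) ⟩
  vandermonde var * tableauSum (doubleWeight n) (diagram 0 (rows parts n))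
    ≈⟨ vandermonde-tableauSum n (rows-Decreasing decreasing n) (doubleWeight-FactorialWeights n) ⟩
  detᶜ n (columns var (rows parts n))
    ≈⟨ det≈detᶜ-columns n parts ⟨
  det (λ i j → ⟨_‖a⟩^_ n (var i) (part parts (toℕ j) ℕ.+ (n ∸ suc (toℕ j))))
    -- The factor 1 is the denominator of the polynomial side after cross-multiplication.
    ≈⟨ *-identityʳ _ ⟨
  _ ∎
  where
  open Partition ν
  open CommutativeRing (ℚ[a][x] n)
  open RingOps (ℚ[a][x] n)
  open Determinants (ℚ[a][x] n)
  open TableauSums (ℚ[a][x] n)
  open FactorialPowers (ℚ[a][x] n) (λ k → con (a (n ⊖ k)))
  open FactorialTableaux (ℚ[a][x] n) (λ k → con (a (n ⊖ k)))
  open SetoidReasoning setoid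
... | no ℓ≰n = *-congʳ (begin
  evaluate-y=-aₙ n (superSchur ν n)
    ≈⟨ evaluate-superSchur n parts ⟩
  tableauSum (doubleWeight n) (skew parts [])
    ≈⟨ tableauSum-zero (doubleWeight n) (skew parts []) (λ i i≤n →
         first-column (ℕ.≤-<-trans i≤n (ℕ.≰⇒> ℓ≰n))) ⟩
  0# ∎)
  where
  open Partition ν
  open CommutativeRing (ℚ[a][x] n)
  open TableauSums (ℚ[a][x] n)
  open SetoidReasoning setoid

  first-column : ∀ {i} → i < length parts → (i , 0) ∈ skew parts []
  -- The diagram is read with `length parts` rows, because `rows parts n` would cut it off in this
  -- case.
  first-column {i} i<ℓ = ≡.subst ((i , 0) ∈_) (≡.sym (skew-[] parts ℕ.≤-refl))
    (∈-diagram⁺ 0 (rows parts (length parts)) i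
      (≡.subst (0 <_) (≡.sym (partᵛ-rows parts i<ℓ)) (part-positive positive i<ℓ)))
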